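{- $H'$ is a free, infinitely generated monoid. It acts on $\mathcal P$ by left multiplication ($M(x,y,z)^t\in\mathcal P$ for all $M\in H'$, $(x,y,z)\in\mathcal P$), and this action is free in the sense that for each $(x,y,z)\in\mathcal P$ there is a unique $M\in H'$ with $M(1,0,1)^t=(x,y,z)^t$. With respect to this action, $\mathcal P$ (with root $(1,0,1)$) has the structure of the Cayley digraph of $H'$ with respect to a free generating set, which is a regular rooted infinite tree in which every vertex has infinite degree.
   Context: Let $\mathfrak P=\{(x,y,z)\in\mathbb Z_{>0}^3: 2\mid y,\ \gcd(x,y,z)=1,\ x^2+y^2=z^2\}$ and $\mathcal P=\{(x,y,z)\in\mathfrak P:\min\{x,y\}<z/2\}\cup\{(1,0,1)\}$. Let $A=\begin{pmatrix}1&-2&2\\2&-1&2\\2&-2&3\end{pmatrix}$, $B=\begin{pmatrix}1&2&2\\2&1&2\\2&2&3\end{pmatrix}$, $C=\begin{pmatrix}-1&2&2\\-2&1&2\\-2&2&3\end{pmatrix}$, and let $G$ be the monoid generated by $I_3,A,B,C$ under matrix multiplication, acting on triples as column vectors. Let $H$ be the set of all matrices of the forms $A^2NB$, $A^kB$, $ABNB$, $C^2NB$, $C^kB$, $CBNB$, $(AC)^kA^2NB$, $(AC)^kABNB$, $(AC)^kAB$, $(CA)^kC^2NB$, $(CA)^kCBNB$, $(CA)^kCB$, with $N\in G$ and $k\in\mathbb Z_{>0}$, and $H'=H\cup\{I_3\}$. For a monoid with generating set $X$, its Cayley digraph has the elements as vertices and an edge $g\to h$ whenever $h=gx$ for some $x\in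 X$. -}

module Defs where

open import Algebra.Bundles using (Monoid)
open import Algebra.Morphism.Structures using (module MonoidMorphisms)
import Algebra.Definitions.RawMonoid as RawMonoidPower
open import Data.Integer.Base as ℤ using (ℤ; +_; 0ℤ; 1ℤ; _+_; _*_; _⊓_)
open import Data.Integer.Divisibility using (_∣_)
open import Data.Integer.GCD using (gcd)
open import Data.Integer.Tactic.RingSolver using (solve-∀)
open import Data.List.Base as List using (List; []; _∷_; ++-[]-rawMonoid)
open import Data.List.Effectful.Foldable using (foldMap)
import Data.List.Membership.Setoid as SetoidMembership
open import Data.List.Relation.Binary.Pointwise.Base using (Pointwise)
open import Data.Nat.Base as ℕ using (ℕ)
open import Data.Product using (Σ; ∃; ∃!; _×_; _,_; proj₁; proj₂)
open import Data.Rational.Unnormalised.Base as ℚᵘ using (_/_)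
open import Data.Sum.Base using (inj₂)
open import Data.Vec.Base as Vec using (Vec; []; _∷_)
open import Function.Bundles using (Bijection; Injection; _⇔_)
open import Function.Structures using (IsBijection)
open import Level using (0ℓ)
open import Relation.Binary.Bundles using (Setoid)
open import Relation.Binary.Core using (Rel)
import Relation.Binary.Construct.On as On
open import Relation.Binary.PropositionalEquality as ≡ using (_≡_; refl; sym; trans; cong₂)
open import Relation.Unary using (Pred; _∈_; _∪_; _∩_; ｛_｝)

------------------------------------------------------------------------
-- 3×3 integer matrices (as vectors of rows) and column vectors

Triple : Set
Triple = Vec ℤ 3

Matrix : Set
Matrix = Vec (Vec ℤ 3) 3

infix  8 _·_
infixl 7 _*ₘ_
infixr 7 _*ᵥ_

_·_ : ∀ {n} → Vec ℤ n → Vec ℤ n → ℤ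
u · v = Vec.foldr′ _+_ 0ℤ (Vec.zipWith _*_ u v)

_*ᵥ_ : Matrix → Triple → Triple
M *ᵥ v = Vec.map (_· v) M

_*ₘ_ : Matrix → Matrix → Matrix
M *ₘ N = Vec.map (λ row → Vec.map (row ·_) (Vec.transpose N)) M

I₃ A B C : Matrix
I₃ = (+ 1 ∷ + 0 ∷ + 0 ∷ [])
   ∷ (+ 0 ∷ + 1 ∷ + 0 ∷ [])
   ∷ (+ 0 ∷ + 0 ∷ + 1 ∷ []) ∷ []
A  = (+ 1 ∷ ℤ.- + 2 ∷ + 2 ∷ [])
   ∷ (+ 2 ∷ ℤ.- + 1 ∷ + 2 ∷ [])
   ∷ (+ 2 ∷ ℤ.- + 2 ∷ + 3 ∷ []) ∷ []
B  = (+ 1 ∷ + 2 ∷ + 2 ∷ [])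
   ∷ (+ 2 ∷ + 1 ∷ + 2 ∷ [])
   ∷ (+ 2 ∷ + 2 ∷ + 3 ∷ []) ∷ []
C  = (ℤ.- + 1 ∷ + 2 ∷ + 2 ∷ [])
   ∷ (ℤ.- + 2 ∷ + 1 ∷ + 2 ∷ [])
   ∷ (ℤ.- + 2 ∷ + 2 ∷ + 3 ∷ []) ∷ []

private
  ≡₃ : ∀ {X : Set} {a b c a′ b′ c′ : X} → a ≡ a′ → b ≡ b′ → c ≡ c′ →
       _≡_ {A = Vec X 3} (a ∷ b ∷ c ∷ []) (a′ ∷ b′ ∷ c′ ∷ [])
  ≡₃ refl refl refl = refl

  expandʳ : ∀ a b c m n o x →
    (a * m + (b * n + (c * o + 0ℤ))) * x ≡ a * (m * x) + (b * (n * x) + c * (o * x))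
  expandʳ = solve-∀

  expandˡ : ∀ a m n o → a * (m + (n + (o + 0ℤ))) ≡ a * m + (a * n + a * o)
  expandˡ = solve-∀

  exchange : ∀ p₁ q₁ r₁ p₂ q₂ r₂ p₃ q₃ r₃ →
      (p₁ + (q₁ + r₁)) + ((p₂ + (q₂ + r₂)) + ((p₃ + (q₃ + r₃)) + 0ℤ))
    ≡ (p₁ + (p₂ + p₃)) + ((q₁ + (q₂ + q₃)) + ((r₁ + (r₂ + r₃)) + 0ℤ))
  exchange = solve-∀

  ·-assoc : ∀ u (M : Matrix) v → Vec.map (u ·_) (Vec.transpose M) · v ≡ u · (M *ᵥ v)
  ·-assoc (a ∷ b ∷ c ∷ [])
          ((m₁ ∷ m₂ ∷ m₃ ∷ []) ∷ (m₄ ∷ m₅ ∷ m₆ ∷ []) ∷ (m₇ ∷ m₈ ∷ m₉ ∷ []) ∷ [])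
          (x ∷ y ∷ z ∷ []) =
    trans (sum₃ (expandʳ a b c m₁ m₄ m₇ x) (expandʳ a b c m₂ m₅ m₈ y) (expandʳ a b c m₃ m₆ m₉ z))
    (trans (exchange (a * (m₁ * x)) (b * (m₄ * x)) (c * (m₇ * x))
                     (a * (m₂ * y)) (b * (m₅ * y)) (c * (m₈ * y))
                     (a * (m₃ * z)) (b * (m₆ * z)) (c * (m₉ * z)))
    (sym (sum₃ (expandˡ a (m₁ * x) (m₂ * y) (m₃ * z)) (expandˡ b (m₄ * x) (m₅ * y) (m₆ * z))
               (expandˡ c (m₇ * x) (m₈ * y) (m₉ * z)))))
    where
    sum₃ : ∀ {p q r p′ q′ r′} → p ≡ p′ → q ≡ q′ → r ≡ r′ →
           p + (q + (r + 0ℤ)) ≡ p′ + (q′ + (r′ + 0ℤ))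
    sum₃ refl refl refl = refl

  unit₁ : ∀ a b c →
    1ℤ * a + (0ℤ * b + (0ℤ * c + 0ℤ)) ≡ a
  unit₁ = solve-∀
  unit₂ : ∀ a b c →
    0ℤ * a + (1ℤ * b + (0ℤ * c + 0ℤ)) ≡ b
  unit₂ = solve-∀
  unit₃ : ∀ a b c →
    0ℤ * a + (0ℤ * b + (1ℤ * c + 0ℤ)) ≡ c
  unit₃ = solve-∀
  unit₁ʳ : ∀ a b c →
    a * 1ℤ + (b * 0ℤ + (c * 0ℤ + 0ℤ)) ≡ a
  unit₁ʳ = solve-∀
  unit₂ʳ : ∀ a b c →
    a * 0ℤ + (b * 1ℤ + (c * 0ℤ + 0ℤ)) ≡ b
  unit₂ʳ = solve-∀
  unit₃ʳ : ∀ a b c →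
    a * 0ℤ + (b * 0ℤ + (c * 1ℤ + 0ℤ)) ≡ c
  unit₃ʳ = solve-∀

*ₘ-assoc : ∀ L M N → (L *ₘ M) *ₘ N ≡ L *ₘ (M *ₘ N)
*ₘ-assoc (l₁ ∷ l₂ ∷ l₃ ∷ []) M@(_ ∷ _ ∷ _ ∷ [])
         N@((p ∷ q ∷ r ∷ []) ∷ (s ∷ t ∷ u ∷ []) ∷ (x ∷ y ∷ z ∷ []) ∷ []) =
  ≡₃ (row l₁) (row l₂) (row l₃)
  where
  row : ∀ l → Vec.map (Vec.map (l ·_) (Vec.transpose M) ·_) (Vec.transpose N)
            ≡ Vec.map (l ·_) (Vec.transpose (M *ₘ N))
  row l = ≡₃ (·-assoc l M (p ∷ s ∷ x ∷ [])) (·-assoc l M (q ∷ t ∷ y ∷ []))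
             (·-assoc l M (r ∷ u ∷ z ∷ []))

*ₘ-identityˡ : ∀ M → I₃ *ₘ M ≡ M
*ₘ-identityˡ ((a ∷ b ∷ c ∷ []) ∷ (d ∷ e ∷ f ∷ []) ∷ (g ∷ h ∷ i ∷ []) ∷ []) =
  ≡₃ (≡₃ (unit₁ a d g) (unit₁ b e h) (unit₁ c f i))
     (≡₃ (unit₂ a d g) (unit₂ b e h) (unit₂ c f i))
     (≡₃ (unit₃ a d g) (unit₃ b e h) (unit₃ c f i))

*ₘ-identityʳ : ∀ M → M *ₘ I₃ ≡ M
*ₘ-identityʳ ((a ∷ b ∷ c ∷ []) ∷ (d ∷ e ∷ f ∷ []) ∷ (g ∷ h ∷ i ∷ []) ∷ []) =
  ≡₃ (row a b c) (row d e f) (row g h i)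
  where
  row : ∀ a b c → _
  row a b c = ≡₃ (unit₁ʳ a b c) (unit₂ʳ a b c) (unit₃ʳ a b c)

matrixMonoid : Monoid 0ℓ 0ℓ
matrixMonoid = record
  { Carrier = Matrix
  ; _≈_ = _≡_
  ; _∙_ = _*ₘ_
  ; ε = I₃
  ; isMonoid = record
    { isSemigroup = record
      { isMagma = record
        { isEquivalence = ≡.isEquivalence
        ; ∙-cong = cong₂ _*ₘ_
        }
      ; assoc = *ₘ-assoc
      }
    ; identity = *ₘ-identityˡ , *ₘ-identityʳ
    }
  }

infixr 8 _^_

_^_ : Matrix → ℕ → Matrix
M ^ k = RawMonoidPower._×_ (Monoid.rawMonoid matrixMonoid) k M

------------------------------------------------------------------------
-- Monoids: submonoids, generation, freeness

record IsSubmonoid (M : Monoid 0ℓ 0ℓ) (S : Pred (Monoid.Carrier M) 0ℓ) : Set where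
  open Monoid M
  field
    ε-closed : ε ∈ S
    ∙-closed : ∀ {x y} → x ∈ S → y ∈ S → x ∙ y ∈ S

submonoid : (M : Monoid 0ℓ 0ℓ) {S : Pred (Monoid.Carrier M) 0ℓ} →
            IsSubmonoid M S → Monoid 0ℓ 0ℓ
submonoid M {S} isSub = record
  { Carrier = Σ Carrier S
  ; _≈_ = λ x y → proj₁ x ≈ proj₁ y
  ; _∙_ = λ x y → proj₁ x ∙ proj₁ y , ∙-closed (proj₂ x) (proj₂ y)
  ; ε = ε , ε-closed
  ; isMonoid = record
    { isSemigroup = record
      { isMagma = record
        { isEquivalence = On.isEquivalence proj₁ isEquivalence
        ; ∙-cong = ∙-cong
        }
      ; assoc = λ x y z → assoc (proj₁ x) (proj₁ y) (proj₁ z)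
      }
    ; identity = (λ x → identityˡ (proj₁ x)) , (λ x → identityʳ (proj₁ x))
    }
  }
  where
  open Monoid M
  open IsSubmonoid isSub

module _ (M : Monoid 0ℓ 0ℓ) where
  open Monoid M hiding (refl; sym; trans)
  open SetoidMembership setoid using () renaming (_∈_ to _∈ₗ_)

  data Generated (X : Pred Carrier 0ℓ) : Pred Carrier 0ℓ where
    incl : ∀ {x} → x ∈ X → Generated X x
    unit : Generated X ε
    mul  : ∀ {x y} → Generated X x → Generated X y → Generated X (x ∙ y)
    resp : ∀ {x y} → x ≈ y → Generated X x → Generated X y

  FinitelyGenerated : Set
  FinitelyGenerated = ∃ λ (xs : List Carrier) → ∀ g → Generated (_∈ₗ xs) g

  -- The free monoid on a set Gen is the monoid of words List Gen. A family
  -- gen freely generates M when the induced homomorphism from words to M is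
  -- an isomorphism; gen is then injective, so it amounts to a subset of M.
  FreelyGenerates : {Gen : Set} → (Gen → Carrier) → Set
  FreelyGenerates {Gen} gen = IsMonoidIsomorphism (foldMap rawMonoid gen)
    where open MonoidMorphisms (++-[]-rawMonoid Gen) rawMonoid

  IsFree : Set₁
  IsFree = ∃ λ (Gen : Set) → ∃ λ (gen : Gen → Carrier) → FreelyGenerates gen

  Range : {Gen : Set} → (Gen → Carrier) → Pred Carrier 0ℓ
  Range gen x = ∃ λ i → x ≈ gen i

------------------------------------------------------------------------
-- Digraphs

record Digraph : Set₁ where
  field
    vertices : Setoid 0ℓ 0ℓ
  open Setoid vertices public renaming (Carrier to Vertex) using (_≈_)
  field
    Edge : Rel Vertex 0ℓ

cayley : (M : Monoid 0ℓ 0ℓ) → Pred (Monoid.Carrier M) 0ℓ → Digraph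
cayley M X = record
  { vertices = setoid
  ; Edge     = λ g h → ∃ λ x → x ∈ X × h ≈ g ∙ x
  }
  where open Monoid M

Infinite : Setoid 0ℓ 0ℓ → Set
Infinite S = Injection (≡.setoid ℕ) S

module _ (Γ : Digraph) where
  open Digraph Γ

  -- IsWalk u v ws: the vertices after u on a directed walk from u to v are,
  -- in order, those of ws.
  IsWalk : Vertex → Vertex → Pred (List Vertex) 0ℓ
  IsWalk u v []       = u ≈ v
  IsWalk u v (w ∷ ws) = Edge u w × IsWalk w v ws

  -- Rooted trees are oriented away from the root: every vertex is reached
  -- from the root by exactly one directed walk.
  IsRootedTree : Vertex → Set
  IsRootedTree r = ∀ v → ∃! (Pointwise _≈_) (IsWalk r v)

  children : Vertex → Setoid 0ℓ 0ℓ
  children v = On.setoid {B = ∃ (Edge v)} vertices proj₁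

  record IsRegularInfiniteTreeOfInfiniteDegree (r : Vertex) : Set where
    field
      rootedTree     : IsRootedTree r
      infinite       : Infinite vertices
      regular        : ∀ u v → Bijection (children u) (children v)
      infiniteDegree : ∀ v → Infinite (children v)

record IsRootedIsomorphism (Γ Δ : Digraph) (r : Digraph.Vertex Γ) (s : Digraph.Vertex Δ)
                           (f : Digraph.Vertex Γ → Digraph.Vertex Δ) : Set where
  private
    module Γ = Digraph Γ
    module Δ = Digraph Δ
  field
    isBijection : IsBijection Γ._≈_ Δ._≈_ f
    edge⇔       : ∀ u v → Γ.Edge u v ⇔ Δ.Edge (f u) (f v)
    root        : f r Δ.≈ s

------------------------------------------------------------------------
-- Pythagorean triples

𝔓 : Pred Triple 0ℓ
𝔓 (x ∷ y ∷ z ∷ []) =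
    (x ℤ.> 0ℤ × y ℤ.> 0ℤ × z ℤ.> 0ℤ)
  × + 2 ∣ y
  × gcd (gcd x y) z ≡ 1ℤ
  × x * x + y * y ≡ z * z

Thin : Pred Triple 0ℓ
Thin (x ∷ y ∷ z ∷ []) = (x ⊓ y) / 1 ℚᵘ.< z / 2

root : Triple
root = + 1 ∷ + 0 ∷ + 1 ∷ []

𝒫 : Pred Triple 0ℓ
𝒫 = (𝔓 ∩ Thin) ∪ ｛ root ｝

root∈𝒫 : root ∈ 𝒫
root∈𝒫 = inj₂ refl

------------------------------------------------------------------------
-- The monoids G and H′

data IABC : Pred Matrix 0ℓ where
  I∈ : IABC I₃
  A∈ : IABC A
  B∈ : IABC B
  C∈ : IABC C

G : Pred Matrix 0ℓ
G = Generated matrixMonoid IABC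

data H : Pred Matrix 0ℓ where
  A²NB      : ∀ {N} → N ∈ G → H (A ^ 2 *ₘ N *ₘ B)
  AᵏB       : ∀ {k} → k ℕ.> 0 → H (A ^ k *ₘ B)
  ABNB      : ∀ {N} → N ∈ G → H (A *ₘ B *ₘ N *ₘ B)
  C²NB      : ∀ {N} → N ∈ G → H (C ^ 2 *ₘ N *ₘ B)
  CᵏB       : ∀ {k} → k ℕ.> 0 → H (C ^ k *ₘ B)
  CBNB      : ∀ {N} → N ∈ G → H (C *ₘ B *ₘ N *ₘ B)
  [AC]ᵏA²NB : ∀ {k N} → k ℕ.> 0 → N ∈ G → H ((A *ₘ C) ^ k *ₘ A ^ 2 *ₘ N *ₘ B)
  [AC]ᵏABNB : ∀ {k N} → k ℕ.> 0 → N ∈ G → H ((A *ₘ C) ^ k *ₘ A *ₘ B *ₘ N *ₘ B)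
  [AC]ᵏAB   : ∀ {k} → k ℕ.> 0 → H ((A *ₘ C) ^ k *ₘ A *ₘ B)
  [CA]ᵏC²NB : ∀ {k N} → k ℕ.> 0 → N ∈ G → H ((C *ₘ A) ^ k *ₘ C ^ 2 *ₘ N *ₘ B)
  [CA]ᵏCBNB : ∀ {k N} → k ℕ.> 0 → N ∈ G → H ((C *ₘ A) ^ k *ₘ C *ₘ B *ₘ N *ₘ B)
  [CA]ᵏCB   : ∀ {k} → k ℕ.> 0 → H ((C *ₘ A) ^ k *ₘ C *ₘ B)

H′ : Pred Matrix 0ℓ
H′ = H ∪ ｛ I₃ ｝

------------------------------------------------------------------------
-- The action on 𝒫

record ActsOn (S : Pred Matrix 0ℓ) (P : Pred Triple 0ℓ) : Set where
  field
    closed     : ∀ {M v} → M ∈ S → v ∈ P → M *ᵥ v ∈ P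
    identity   : ∀ {v} → v ∈ P → I₃ *ᵥ v ≡ v
    compatible : ∀ {M N v} → M ∈ S → N ∈ S → v ∈ P → (M *ₘ N) *ᵥ v ≡ M *ᵥ N *ᵥ v

module _ (isSub : IsSubmonoid matrixMonoid H′) (acts : ActsOn H′ 𝒫) where
  open Monoid (submonoid matrixMonoid isSub)

  orbitMap : Carrier → Σ Triple 𝒫
  orbitMap (M , M∈H′) = M *ᵥ root , ActsOn.closed acts M∈H′ root∈𝒫

  -- The digraph structure that a generating set X of H′ induces on 𝒫
  -- through the action on the root: edges M·root → (Mx)·root with x ∈ X.
  orbitDigraph : Pred Carrier 0ℓ → Digraph
  orbitDigraph X = record
    { vertices = On.setoid {B = Σ Triple 𝒫} (≡.setoid Triple) proj₁
    ; Edge     = λ v w → ∃ λ g → ∃ λ x → x ∈ X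
                 × proj₁ v ≡ proj₁ (orbitMap g)
                 × proj₁ w ≡ proj₁ (orbitMap (g ∙ x))
    }

{-# OPTIONS --safe #-}

-- Berggren's tree identifies 𝔓 with the words over {A, B, C} that end in B, through
-- w ↦ w·(1,0,1): the letter preceding a triple v is read off the signs of the coordinates
-- p, q of B⁻¹v, and the hypotenuse decreases along the way. Under this bijection 2x < z
-- (resp. 2y < z) says that the longest prefix alternating between A and C starts with A
-- (resp. C) and has odd length, because 2x < z holds at ACv exactly when it holds at v.
-- Hence H consists of the words with such an odd prefix that end in B. A prefix ending in B
-- of a word in H is again in H, so all cuts of a word before a suffix in H, after a letter B,
-- are compatible; cutting everywhere gives the unique factorisation into irreducible words,
-- among which are all ABⁿ.
module Submission where

open import Algebra.Bundles using (Monoid)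
open import Algebra.Morphism.Structures using (module MonoidMorphisms)
open import Data.Bool.Properties using (T-irrelevant)
open import Data.Empty using (⊥-elim)
open import Data.Integer.Base using (ℤ; +_; -[1+_]; 0ℤ; 1ℤ; _+_; _*_; _-_; -_; _<_; _≤_; +<+; +≤+; -<+; -≤+)
open import Data.Integer.Divisibility.Signed using (_∣_; divides; ∣ᵤ⇒∣; ∣⇒∣ᵤ; ∣-trans; ∣m∣n⇒∣m+n; ∣n⇒∣m*n; ∣m⇒∣m*n)
open import Data.Integer.GCD using (gcd; gcd-greatest; gcd[i,j]∣i; gcd[i,j]∣j)
import Data.Integer.Properties as ℤ
open import Data.Integer.Tactic.RingSolver using (solve-∀)
open import Data.List.Base as List using (List; []; _∷_; _++_; ++-[]-rawMonoid; concatMap; length; replicate)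
open import Data.List.Effectful.Foldable using (foldMap; foldMap-morphism)
import Data.List.Membership.Setoid as SetoidMembership
open import Data.List.Properties using (∷-injective; ∷-injectiveˡ; ∷-injectiveʳ; ++-identityʳ; ++-cancelˡ; length-replicate)
open import Data.List.Relation.Binary.Pointwise.Base using (Pointwise; []; _∷_)
open import Data.List.Relation.Unary.All as All using (All; []; _∷_)
import Data.List.Relation.Unary.All.Properties as All
open import Data.List.Relation.Unary.Any using (here; there)
open import Data.Nat.Base as ℕ using (ℕ; zero; suc; s≤s; z≤n; _⊔_)
import Data.Nat.Divisibility as ℕ
import Data.Nat.Properties as ℕ
open import Data.Product using (Σ; ∃; ∃!; _×_; _,_; proj₁; proj₂; map₁)
open import Data.Rational.Unnormalised.Base using (*<*)
open import Data.Sum.Base using (_⊎_; inj₁; inj₂)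
open import Data.Vec.Base as Vec using ([]; _∷_)
open import Function.Base using (_∘_)
open import Function.Bundles using (Bijection; mk⇔)
open import Level using (0ℓ)
import Relation.Binary.Construct.On as On
open import Relation.Binary.Definitions using (Tri; tri<; tri≈; tri>)
open import Relation.Binary.PropositionalEquality as ≡ using (_≡_; refl; cong; cong₂; subst; sym; trans)
open import Relation.Nullary using (¬_; Dec; yes; no)
open import Relation.Nullary.Decidable using (map′; _×-dec_; _⊎-dec_; ¬?; True; toWitness; fromWitness)
open import Relation.Unary using (Pred; _∈_)
open import Defs

-- Free monoids and their Cayley digraphs

module FreeMonoid (M : Monoid 0ℓ 0ℓ) {Gen : Set} (gen : Gen → Monoid.Carrier M)
                  (free : FreelyGenerates M gen) where
  open Monoid M
    renaming (refl to ≈-refl; sym to ≈-sym; trans to ≈-trans) hiding (isMonoid)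
  open MonoidMorphisms (++-[]-rawMonoid Gen) rawMonoid
  open IsMonoidIsomorphism free using (injective; surjective; homo)

  open SetoidMembership setoid using () renaming (_∈_ to _∈ₗ_)

  Γ : Digraph
  Γ = cayley M (Range M gen)

  ⟦_⟧ : List Gen → Carrier
  ⟦_⟧ = foldMap rawMonoid gen

  word : Carrier → List Gen
  word g = proj₁ (surjective g)

  ⟦word⟧ : ∀ g → ⟦ word g ⟧ ≈ g
  ⟦word⟧ g = proj₂ (surjective g) refl

  word-unique : ∀ {g} is → g ≈ ⟦ is ⟧ → word g ≡ is
  word-unique {g} is g≈ = injective (≈-trans (⟦word⟧ g) g≈)

  word-∙ : ∀ g h → word (g ∙ h) ≡ word g ++ word h
  word-∙ g h = word-unique (word g ++ word h)
    (≈-sym (≈-trans (homo (word g) (word h)) (∙-cong (⟦word⟧ g) (⟦word⟧ h))))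

  word-cong : ∀ {g h} → g ≈ h → word g ≡ word h
  word-cong {h = h} g≈h = word-unique (word h) (≈-trans g≈h (≈-sym (⟦word⟧ h)))

  word-injective : ∀ {g h} → word g ≡ word h → g ≈ h
  word-injective {g} {h} eq =
    ≈-trans (≈-sym (⟦word⟧ g)) (≈-trans (reflexive (cong ⟦_⟧ eq)) (⟦word⟧ h))

  -- Cancellation is inherited from words, since products become concatenations under `word`.
  ∙-cancelˡ : ∀ g {h k} → g ∙ h ≈ g ∙ k → h ≈ k
  ∙-cancelˡ g {h} {k} eq = word-injective (++-cancelˡ (word g) (word h) (word k)
    (≡.trans (≡.sym (word-∙ g h)) (≡.trans (word-cong eq) (word-∙ g k))))

  gen-injective : ∀ {i j} → gen i ≈ gen j → i ≡ j
  gen-injective {i} {j} eq =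
    ∷-injectiveˡ (injective {i ∷ []} {j ∷ []} (∙-cong eq ≈-refl))

  path : Carrier → List Gen → List Carrier
  path g []       = []
  path g (i ∷ is) = g ∙ gen i ∷ path (g ∙ gen i) is

  path-cong : ∀ {g h} is → g ≈ h → Pointwise _≈_ (path g is) (path h is)
  path-cong []       g≈h = []
  path-cong (i ∷ is) g≈h = ∙-cong g≈h ≈-refl ∷ path-cong is (∙-cong g≈h ≈-refl)

  path-isWalk : ∀ {g h} is → g ∙ ⟦ is ⟧ ≈ h → IsWalk Γ g h (path g is)
  path-isWalk []       eq = ≈-trans (≈-sym (identityʳ _)) eq
  path-isWalk (i ∷ is) eq =
    (gen i , (i , ≈-refl) , ≈-refl) , path-isWalk is (≈-trans (assoc _ _ _) eq)

  -- Converse of `path-isWalk`: reading off the generator on each edge shows that every walk is, up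
  -- to `_≈_`, the path of some word.
  walk-labels : ∀ {g h} ws → IsWalk Γ g h ws →
                ∃ λ is → g ∙ ⟦ is ⟧ ≈ h × Pointwise _≈_ (path g is) ws
  walk-labels []       g≈h = [] , ≈-trans (identityʳ _) g≈h , []
  walk-labels {g} (w ∷ ws) ((x , (i , x≈i) , w≈gx) , walk)
    with walk-labels ws walk
  ... | is , eq , ps = i ∷ is , ≈-trans (≈-sym (assoc _ _ _)) (≈-trans (∙-cong gi≈w ≈-refl) eq)
                     , gi≈w ∷ trans-path (path-cong is gi≈w) ps
    where
    gi≈w : g ∙ gen i ≈ w
    gi≈w = ≈-trans (∙-cong ≈-refl (≈-sym x≈i)) (≈-sym w≈gx)
    trans-path : ∀ {us vs ws} → Pointwise _≈_ us vs → Pointwise _≈_ vs ws → Pointwise _≈_ us ws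
    trans-path []       []       = []
    trans-path (p ∷ ps) (q ∷ qs) = ≈-trans p q ∷ trans-path ps qs

  -- Walks from `ε` to `v` are the paths of words with value `v`. Surjectivity of evaluation
  -- provides one such word and injectivity makes it the only one.
  rootedTree : IsRootedTree Γ ε
  rootedTree v = path ε (word v)
    , path-isWalk (word v) (≈-trans (identityˡ _) (⟦word⟧ v))
    , λ {ws} walk → unique (walk-labels ws walk)
    where
    unique : ∀ {ws} → (∃ λ is → ε ∙ ⟦ is ⟧ ≈ v × Pointwise _≈_ (path ε is) ws) →
             Pointwise _≈_ (path ε (word v)) ws
    unique {ws} (is , eq , ps) = subst (λ js → Pointwise _≈_ (path ε js) ws)
      (≡.sym (word-unique is (≈-trans (≈-sym eq) (identityˡ _)))) ps

  child : ∀ u {x} → x ∈ Range M gen → ∃ (Digraph.Edge Γ u)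
  child u {x} x∈ = u ∙ x , x , x∈ , ≈-refl

  -- Each child of `u` goes to the child of `v` along an edge with the same label; left cancellation
  -- shows that a child determines its label.
  children-bijection : ∀ u v → Bijection (children Γ u) (children Γ v)
  children-bijection u v = record
    { to        = to
    ; cong      = λ {c} {d} → move u v c d
    ; bijective = (λ {c} {d} → to-injective c d)
                , λ { (h , x , x∈ , h≈) → child u x∈ , λ {c} eq →
                    ≈-trans (move u v c (child u x∈) eq) (≈-sym h≈) }
    }
    where
    to : ∃ (Digraph.Edge Γ u) → ∃ (Digraph.Edge Γ v)
    to (h , x , x∈ , h≈) = child v x∈
    move : ∀ u v (c d : ∃ (Digraph.Edge Γ u)) → proj₁ c ≈ proj₁ d →
           v ∙ proj₁ (proj₂ c) ≈ v ∙ proj₁ (proj₂ d)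
    move u v (h , x , x∈ , h≈) (k , y , y∈ , k≈) eq =
      ∙-cong ≈-refl (∙-cancelˡ u (≈-trans (≈-sym h≈) (≈-trans eq k≈)))
    to-injective : ∀ c d → proj₁ (to c) ≈ proj₁ (to d) → proj₁ c ≈ proj₁ d
    to-injective c@(_ , _ , _ , h≈) d@(_ , _ , _ , k≈) eq =
      ≈-trans h≈ (≈-trans (move v u (to c) (to d) eq) (≈-sym k≈))

  module _ (f : ℕ → Gen) (f-injective : ∀ {m n} → f m ≡ f n → m ≡ n) where

    infinite : Infinite setoid
    infinite = record
      { to        = gen ∘ f
      ; cong      = λ { refl → ≈-refl }
      ; injective = f-injective ∘ gen-injective
      }

    infiniteDegree : ∀ v → Infinite (children Γ v)
    infiniteDegree v = record
      { to        = λ n → child v (f n , ≈-refl)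
      ; cong      = λ { refl → ≈-refl }
      ; injective = f-injective ∘ gen-injective ∘ ∙-cancelˡ v
      }

    regularTree : IsRegularInfiniteTreeOfInfiniteDegree Γ ε
    regularTree = record
      { rootedTree     = rootedTree
      ; infinite       = infinite
      ; regular        = children-bijection
      ; infiniteDegree = infiniteDegree
      }

  -- The words of finitely many elements involve only generators of bounded size.
  module _ (size : Gen → ℕ) (unbounded : ∀ n → ∃ λ i → n ℕ.< size i) where

    wordSize : List Gen → ℕ
    wordSize = List.foldr (λ i → size i ⊔_) 0

    Bounded : ℕ → Pred Carrier 0ℓ
    Bounded n g = All (λ i → size i ℕ.≤ n) (word g)

    wordSize-bounds : ∀ is → All (λ i → size i ℕ.≤ wordSize is) is
    wordSize-bounds []       = []
    wordSize-bounds (i ∷ is) = ℕ.m≤m⊔n _ _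
      ∷ All.map (λ le → ℕ.≤-trans le (ℕ.m≤n⊔m (size i) _)) (wordSize-bounds is)

    common-bound : ∀ xs → ∃ λ n → All (Bounded n) xs
    common-bound []       = 0 , []
    common-bound (x ∷ xs) with common-bound xs
    ... | n , bs = wordSize (word x) ⊔ n
      , All.map (λ le → ℕ.≤-trans le (ℕ.m≤m⊔n _ n)) (wordSize-bounds (word x))
      ∷ All.map (All.map (λ le → ℕ.≤-trans le (ℕ.m≤n⊔m (wordSize (word x)) n))) bs

    bounded-resp : ∀ {n g h} → g ≈ h → Bounded n g → Bounded n h
    bounded-resp eq = subst (All _) (word-cong eq)

    generated-bounded : ∀ {X n} → (∀ {x} → x ∈ X → Bounded n x) →
                        ∀ {g} → Generated M X g → Bounded n g
    generated-bounded bd (incl x∈)  = bd x∈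
    generated-bounded bd unit       = subst (All _) (≡.sym (word-unique [] ≈-refl)) []
    generated-bounded bd (mul p q)  = subst (All _) (≡.sym (word-∙ _ _))
      (All.++⁺ (generated-bounded bd p) (generated-bounded bd q))
    generated-bounded bd (resp e p) = bounded-resp e (generated-bounded bd p)

    ¬finitelyGenerated : ¬ FinitelyGenerated M
    ¬finitelyGenerated (xs , generates) with common-bound xs
    ... | n , bs with unbounded n
    ... | i , n<i = ℕ.<⇒≱ n<i (All.head (subst (All _) (word-unique (i ∷ []) (≈-sym (identityʳ _)))
                      (generated-bounded (member bs) (generates (gen i)))))
      where
      member : ∀ {xs n x} → All (Bounded n) xs → x ∈ₗ xs → Bounded n x
      member (b ∷ bs) (here eq)  = bounded-resp (≈-sym eq) b
      member (b ∷ bs) (there x∈) = member bs x∈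

-- Combinatorics of words

data Side : Set where
  α γ : Side

data Letter : Set where
  ⟨_⟩ : Side → Letter
  β   : Letter

Word : Set
Word = List Letter

opp : Side → Side
opp α = γ
opp γ = α

data EndsInβ : Word → Set where
  [β] : EndsInβ (β ∷ [])
  _∷_ : ∀ ℓ {w} → EndsInβ w → EndsInβ (ℓ ∷ w)

-- The maximal prefix alternating between the two sides starts with s and has odd length.
data Head (s : Side) : Word → Set where
  twice : ∀ {w} → Head s (⟨ s ⟩ ∷ ⟨ s ⟩ ∷ w)
  stop  : ∀ {w} → Head s (⟨ s ⟩ ∷ β ∷ w)
  alt   : ∀ {w} → Head s w → Head s (⟨ s ⟩ ∷ ⟨ opp s ⟩ ∷ w)

record HWord (w : Word) : Set where
  constructor hword
  field
    endsInβ : EndsInβ w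
    side    : Side
    head    : Head side w

endsInβ? : ∀ w → Dec (EndsInβ w)
endsInβ? []            = no λ ()
endsInβ? (β ∷ [])      = yes [β]
endsInβ? (⟨ s ⟩ ∷ [])  = no λ { (_ ∷ ()) }
endsInβ? (ℓ ∷ w@(_ ∷ _)) = map′ (ℓ ∷_) (λ { (_ ∷ e) → e }) (endsInβ? w)

head? : ∀ s w → Dec (Head s w)
head? α []                    = no λ ()
head? α (⟨ α ⟩ ∷ [])          = no λ ()
head? α (⟨ α ⟩ ∷ ⟨ α ⟩ ∷ w)   = yes twice
head? α (⟨ α ⟩ ∷ ⟨ γ ⟩ ∷ w)   = map′ alt (λ { (alt h) → h }) (head? α w)
head? α (⟨ α ⟩ ∷ β ∷ w)       = yes stop
head? α (⟨ γ ⟩ ∷ w)           = no λ ()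
head? α (β ∷ w)               = no λ ()
head? γ []                    = no λ ()
head? γ (⟨ γ ⟩ ∷ [])          = no λ ()
head? γ (⟨ γ ⟩ ∷ ⟨ γ ⟩ ∷ w)   = yes twice
head? γ (⟨ γ ⟩ ∷ ⟨ α ⟩ ∷ w)   = map′ alt (λ { (alt h) → h }) (head? γ w)
head? γ (⟨ γ ⟩ ∷ β ∷ w)       = yes stop
head? γ (⟨ α ⟩ ∷ w)           = no λ ()
head? γ (β ∷ w)               = no λ ()

hword? : ∀ w → Dec (HWord w)
hword? w = map′ (λ { (e , inj₁ h) → hword e α h ; (e , inj₂ h) → hword e γ h })
                (λ { (hword e α h) → e , inj₁ h ; (hword e γ h) → e , inj₂ h })
                (endsInβ? w ×-dec (head? α w ⊎-dec head? γ w))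

endsInβ-++ : ∀ u {v} → EndsInβ v → EndsInβ (u ++ v)
endsInβ-++ []      e = e
endsInβ-++ (ℓ ∷ u) e = ℓ ∷ endsInβ-++ u e

head-++ : ∀ {s u} v → Head s u → Head s (u ++ v)
head-++ v twice   = twice
head-++ v stop    = stop
head-++ v (alt h) = alt (head-++ v h)

-- The first β of a word ends or follows the odd alternating prefix, so
-- prefixes ending in β decide whether there is one.
head-prefix : ∀ {s u v} → EndsInβ u → Head s (u ++ v) → Head s u
head-prefix [β]                 ()
head-prefix (⟨ s ⟩ ∷ [β])       stop    = stop
head-prefix (⟨ s ⟩ ∷ β ∷ e)     stop    = stop
head-prefix (⟨ s ⟩ ∷ ⟨ _ ⟩ ∷ e) twice   = twice
head-prefix (⟨ s ⟩ ∷ ⟨ _ ⟩ ∷ e) (alt h) = alt (head-prefix e h)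

hword-prefix : ∀ {u v} → EndsInβ u → HWord (u ++ v) → HWord u
hword-prefix e (hword _ s h) = hword e s (head-prefix e h)

hword-++ : ∀ {u v} → HWord u → HWord v → HWord (u ++ v)
hword-++ {u} {v} (hword _ s h) (hword e _ _) = hword (endsInβ-++ u e) s (head-++ v h)

-- Unique factorisation into irreducible words

data Uncut : Word → Set where
  [β]    : Uncut (β ∷ [])
  side-∷ : ∀ {s w} → Uncut w → Uncut (⟨ s ⟩ ∷ w)
  β-∷    : ∀ {w} → ¬ HWord w → Uncut w → Uncut (β ∷ w)

uncut? : ∀ w → Dec (Uncut w)
uncut? []                = no λ ()
uncut? (⟨ s ⟩ ∷ w)       = map′ side-∷ (λ { (side-∷ c) → c }) (uncut? w)
uncut? (β ∷ [])          = yes [β]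
uncut? (β ∷ w@(_ ∷ _))   = map′ (λ { (¬h , c) → β-∷ ¬h c }) (λ { (β-∷ ¬h c) → ¬h , c })
                                (¬? (hword? w) ×-dec uncut? w)

uncut⇒endsInβ : ∀ {w} → Uncut w → EndsInβ w
uncut⇒endsInβ [β]        = [β]
uncut⇒endsInβ (side-∷ c) = _ ∷ uncut⇒endsInβ c
uncut⇒endsInβ (β-∷ _ c)  = _ ∷ uncut⇒endsInβ c

-- `Uncut` says that no nonempty remainder after a letter β is an `HWord`, so there is no place to
-- split the word. Together with `HWord` this singles out the free generators.
Irreducible : Word → Set
Irreducible w = Uncut w × HWord w

irreducible? : ∀ w → Dec (Irreducible w)
irreducible? w = uncut? w ×-dec hword? w

-- Decided by a boolean, so that a generator is determined by its word.
Generator : Set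
Generator = Σ Word λ w → True (irreducible? w)

generator : ∀ {w} → Irreducible w → Generator
generator {w} irr = w , fromWitness irr

generator-≡ : ∀ {i j : Generator} → proj₁ i ≡ proj₁ j → i ≡ j
generator-≡ {w , p} {_ , q} refl = cong (w ,_) (T-irrelevant p q)

uncut : ∀ (i : Generator) → Uncut (proj₁ i)
uncut (_ , irr) = proj₁ (toWitness irr)

generator-hword : ∀ (i : Generator) → HWord (proj₁ i)
generator-hword (_ , irr) = proj₂ (toWitness irr)

HWord′ : Word → Set
HWord′ w = HWord w ⊎ w ≡ []

hword′-++ : ∀ {u v} → HWord u → HWord′ v → HWord (u ++ v)
hword′-++ hu (inj₁ hv)           = hword-++ hu hv
hword′-++ {u} hu (inj₂ refl) = subst HWord (sym (++-identityʳ u)) hu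

flatten : List Generator → Word
flatten = concatMap proj₁

flatten-hword′ : ∀ is → HWord′ (flatten is)
flatten-hword′ []       = inj₂ refl
flatten-hword′ (i ∷ is) = inj₁ (hword′-++ (generator-hword i) (flatten-hword′ is))

-- A greedy scan from the right: a cut is made after β whenever the remainder is an `HWord`. The
-- first piece `u` of that remainder is then an `HWord` by `hword-prefix`, hence a generator. If the
-- remainder is not an `HWord`, neither is `u`, because appending generators to an `HWord` gives an
-- `HWord`; so β may be joined to `u`.
cut : ∀ {w} → EndsInβ w → ∃ λ u → ∃ λ is → Uncut u × u ++ flatten is ≡ w
cut [β]           = β ∷ [] , [] , [β] , refl
cut (⟨ s ⟩ ∷ e)   with cut e
... | u , is , c , eq = ⟨ s ⟩ ∷ u , is , side-∷ c , cong (⟨ s ⟩ ∷_) eq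
cut (_∷_ β {w} e) with cut e | hword? w
... | u , is , c , refl | yes h =
  β ∷ [] , generator (c , hword-prefix (uncut⇒endsInβ c) h) ∷ is , [β] , refl
... | u , is , c , refl | no ¬h =
  β ∷ u , is , β-∷ (λ h → ¬h (hword′-++ h (flatten-hword′ is))) c , refl

factor : ∀ {w} → HWord′ w → ∃ λ is → flatten is ≡ w
factor (inj₂ refl) = [] , refl
factor (inj₁ h) with cut (HWord.endsInβ h)
... | u , is , c , refl = generator (c , hword-prefix (uncut⇒endsInβ c) h) ∷ is , refl

-- As `u` ends in β, it would be an `HWord` along with `w`, and then `β ∷ u` could be cut after its
-- first letter. In `cut-unique` this excludes that one cut comes earlier than the other.
uncut-prefix : ∀ {u v w} → Uncut (β ∷ u) → Uncut u → HWord′ w → ¬ (w ≡ u ++ v)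
uncut-prefix [β] () _ _
uncut-prefix (β-∷ ¬h _) c (inj₁ h) refl    = ¬h (hword-prefix (uncut⇒endsInβ c) h)
uncut-prefix (β-∷ ¬h _) [β] (inj₂ refl) ()
uncut-prefix (β-∷ ¬h _) (side-∷ _) (inj₂ refl) ()
uncut-prefix (β-∷ ¬h _) (β-∷ _ _) (inj₂ refl) ()

cut-unique : ∀ {u u′ v v′} → Uncut u → Uncut u′ → HWord′ v → HWord′ v′ →
             u ++ v ≡ u′ ++ v′ → u ≡ u′ × v ≡ v′
cut-unique [β]           [β]              h h′ refl = refl , refl
cut-unique [β]           c′@(β-∷ _ d′)    h h′ eq   = ⊥-elim (uncut-prefix c′ d′ h (∷-injectiveʳ eq))
cut-unique c@(β-∷ _ d)   [β]              h h′ eq   = ⊥-elim (uncut-prefix c d h′ (sym (∷-injectiveʳ eq)))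
cut-unique (β-∷ _ c)     (β-∷ _ c′)       h h′ eq   =
  map₁ (cong (β ∷_)) (cut-unique c c′ h h′ (∷-injectiveʳ eq))
cut-unique (side-∷ {s} c) (side-∷ c′)     h h′ eq   with ∷-injective eq
... | refl , eq′ = map₁ (cong (⟨ s ⟩ ∷_)) (cut-unique c c′ h h′ eq′)
cut-unique [β]           (side-∷ _)       h h′ ()
cut-unique (side-∷ _)    [β]              h h′ ()
cut-unique (side-∷ _)    (β-∷ _ _)        h h′ ()
cut-unique (β-∷ _ _)     (side-∷ _)       h h′ ()

uncut-nonempty : ∀ {u v : Word} → Uncut u → ¬ ([] ≡ u ++ v)
uncut-nonempty [β]        ()
uncut-nonempty (side-∷ _) ()
uncut-nonempty (β-∷ _ _)  ()

flatten-injective : ∀ is js → flatten is ≡ flatten js → is ≡ js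
flatten-injective []       []       eq = refl
flatten-injective []       (j ∷ js) eq = ⊥-elim (uncut-nonempty (uncut j) eq)
flatten-injective (i ∷ is) []       eq = ⊥-elim (uncut-nonempty (uncut i) (sym eq))
flatten-injective (i ∷ is) (j ∷ js) eq
  with cut-unique (uncut i) (uncut j) (flatten-hword′ is) (flatten-hword′ js) eq
... | i≡j , eq′ = cong₂ _∷_ (generator-≡ i≡j) (flatten-injective is js eq′)

-- The word has `n + 1` letters β, since it must end in β even for `n = 0`. It is uncut because
-- every remainder after a β is empty or starts with β, and no `Head` starts with β.
αβⁿ : ℕ → Generator
αβⁿ n = generator {⟨ α ⟩ ∷ βⁿ n} (side-∷ (βⁿ-uncut n) , hword (⟨ α ⟩ ∷ uncut⇒endsInβ (βⁿ-uncut n)) α stop)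
  where
  βⁿ : ℕ → Word
  βⁿ n = β ∷ replicate n β
  βⁿ-uncut : ∀ n → Uncut (βⁿ n)
  βⁿ-uncut zero    = [β]
  βⁿ-uncut (suc n) = β-∷ (λ { (hword _ _ ()) }) (βⁿ-uncut n)

size : Generator → ℕ
size i = length (proj₁ i)

size-αβⁿ : ∀ n → size (αβⁿ n) ≡ 2 ℕ.+ n
size-αβⁿ n = cong (2 ℕ.+_) (length-replicate n)

αβⁿ-injective : ∀ {m n} → αβⁿ m ≡ αβⁿ n → m ≡ n
αβⁿ-injective {m} {n} eq = ℕ.+-cancelˡ-≡ 2 m n
  (trans (sym (size-αβⁿ m)) (trans (cong size eq) (size-αβⁿ n)))

size-unbounded : ∀ n → ∃ λ i → n ℕ.< size i
size-unbounded n = αβⁿ n , subst (n ℕ.<_) (sym (size-αβⁿ n)) (ℕ.m<n+m n ℕ.z<s)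

-- Evaluation of words as matrices

-- v is a column of the matrix whose three columns are all v.
*ᵥ-assoc : ∀ M N v → (M *ₘ N) *ᵥ v ≡ M *ᵥ N *ᵥ v
*ᵥ-assoc M@(_ ∷ _ ∷ _ ∷ [])
         N@((_ ∷ _ ∷ _ ∷ []) ∷ (_ ∷ _ ∷ _ ∷ []) ∷ (_ ∷ _ ∷ _ ∷ []) ∷ [])
         v@(_ ∷ _ ∷ _ ∷ []) =
  cong (Vec.map Vec.head) (*ₘ-assoc M N (Vec.map (Vec.replicate 3) v))

I₃-*ᵥ : ∀ v → I₃ *ᵥ v ≡ v
I₃-*ᵥ v@(_ ∷ _ ∷ _ ∷ []) = cong (Vec.map Vec.head) (*ₘ-identityˡ (Vec.map (Vec.replicate 3) v))

mat : Letter → Matrix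
mat ⟨ α ⟩ = A
mat ⟨ γ ⟩ = C
mat β     = B

eval : Word → Matrix
eval []      = I₃
eval (ℓ ∷ w) = mat ℓ *ₘ eval w

eval-++ : ∀ u v → eval (u ++ v) ≡ eval u *ₘ eval v
eval-++ []      v = sym (*ₘ-identityˡ (eval v))
eval-++ (ℓ ∷ u) v = trans (cong (mat ℓ *ₘ_) (eval-++ u v)) (sym (*ₘ-assoc (mat ℓ) (eval u) (eval v)))

infix 4 _↦_
-- A record instead of the bare equation, so that unification can recover `w` from the type;
-- `eval w` alone does not determine it.
record _↦_ (w : Word) (M : Matrix) : Set where
  constructor evaluates
  field
    evaluation : eval w ≡ M

infixl 5 _⊗_
_⊗_ : ∀ {u v M N} → u ↦ M → v ↦ N → u ++ v ↦ M *ₘ N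
_⊗_ {u} {v} (evaluates p) (evaluates q) = evaluates (trans (eval-++ u v) (cong₂ _*ₘ_ p q))

↦-eval : ∀ w → w ↦ eval w
↦-eval w = evaluates refl

letter : ∀ ℓ → ℓ ∷ [] ↦ mat ℓ
letter ℓ = evaluates (*ₘ-identityʳ (mat ℓ))

infixl 8 _^ʷ_
-- Unfolds in step with `_^_` on matrices, so that `power` needs no reassociation.
_^ʷ_ : Word → ℕ → Word
w ^ʷ zero  = []
w ^ʷ suc k = w ++ w ^ʷ k

power : ∀ {w M} k → w ↦ M → w ^ʷ k ↦ M ^ k
power zero    p = ↦-eval []
power (suc k) p = p ⊗ power k p

mat∈G : ∀ ℓ → mat ℓ ∈ G
mat∈G ⟨ α ⟩ = incl A∈
mat∈G ⟨ γ ⟩ = incl C∈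
mat∈G β     = incl B∈

eval∈G : ∀ w → eval w ∈ G
eval∈G []      = unit
eval∈G (ℓ ∷ w) = mul (mat∈G ℓ) (eval∈G w)

G⇒word : ∀ {M} → M ∈ G → ∃ λ w → w ↦ M
G⇒word (incl I∈)     = [] , ↦-eval _
G⇒word (incl A∈)     = ⟨ α ⟩ ∷ [] , ↦-eval _
G⇒word (incl B∈)     = β ∷ [] , ↦-eval _
G⇒word (incl C∈)     = ⟨ γ ⟩ ∷ [] , ↦-eval _
G⇒word unit          = [] , ↦-eval _
G⇒word (mul p q)     with G⇒word p | G⇒word q
... | u , eu | v , ev = u ++ v , eu ⊗ ev
G⇒word (resp refl p) = G⇒word p

-- The matrices in `H` as words

endsInβ-snoc : ∀ w → EndsInβ (w ++ β ∷ [])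
endsInβ-snoc w = endsInβ-++ w [β]

endsInβ⇒snoc : ∀ {w} → EndsInβ w → ∃ λ u → w ≡ u ++ β ∷ []
endsInβ⇒snoc [β]     = [] , refl
endsInβ⇒snoc (ℓ ∷ e) with endsInβ⇒snoc e
... | u , refl = ℓ ∷ u , refl

alternating : Side → Word
alternating s = ⟨ s ⟩ ∷ ⟨ opp s ⟩ ∷ []

side : Side → Word
side s = ⟨ s ⟩ ∷ []

-- The words of the matrices in H, bracketed as there.
data Form (s : Side) : Word → Set where
  twiceNβ : ∀ k w → Form s (((alternating s ^ʷ k ++ side s ^ʷ 2) ++ w) ++ β ∷ [])
  stopNβ  : ∀ k w → Form s ((((alternating s ^ʷ k ++ side s) ++ β ∷ []) ++ w) ++ β ∷ [])
  stopβ   : ∀ k   → Form s ((alternating s ^ʷ k ++ side s) ++ β ∷ [])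

form-alt : ∀ {s w} → Form s w → Form s (⟨ s ⟩ ∷ ⟨ opp s ⟩ ∷ w)
form-alt (twiceNβ k w) = twiceNβ (suc k) w
form-alt (stopNβ k w)  = stopNβ (suc k) w
form-alt (stopβ k)     = stopβ (suc k)

parse : ∀ {s w} → EndsInβ w → Head s w → Form s w
parse (_ ∷ _ ∷ e) twice with endsInβ⇒snoc e
... | u , refl = twiceNβ 0 u
parse (_ ∷ [β])   stop  = stopβ 0
parse (_ ∷ _ ∷ e) stop with endsInβ⇒snoc e
... | u , refl = stopNβ 0 u
parse (_ ∷ _ ∷ e) (alt h) = form-alt (parse e h)

form⇒hword : ∀ {s w} → Form s w → HWord w
form⇒hword {s} (twiceNβ k w) = hword (endsInβ-snoc _) s (go k)
  where
  go : ∀ k → Head s (((alternating s ^ʷ k ++ side s ^ʷ 2) ++ w) ++ β ∷ [])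
  go zero    = twice
  go (suc k) = alt (go k)
form⇒hword {s} (stopNβ k w) = hword (endsInβ-snoc _) s (go k)
  where
  go : ∀ k → Head s ((((alternating s ^ʷ k ++ side s) ++ β ∷ []) ++ w) ++ β ∷ [])
  go zero    = stop
  go (suc k) = alt (go k)
form⇒hword {s} (stopβ k) = hword (endsInβ-snoc _) s (go k)
  where
  go : ∀ k → Head s ((alternating s ^ʷ k ++ side s) ++ β ∷ [])
  go zero    = stop
  go (suc k) = alt (go k)

module _ (s : Side) (k : ℕ) where
  private
    S P : Matrix
    S = mat ⟨ s ⟩
    P = (S *ₘ mat ⟨ opp s ⟩) ^ k

    alternating↦ : alternating s ^ʷ k ↦ P
    alternating↦ = power k (letter ⟨ s ⟩ ⊗ letter ⟨ opp s ⟩)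

  twiceNβ↦ : ∀ {w N} → w ↦ N →
    ((alternating s ^ʷ k ++ side s ^ʷ 2) ++ w) ++ β ∷ [] ↦ P *ₘ S ^ 2 *ₘ N *ₘ B
  twiceNβ↦ n = alternating↦ ⊗ power 2 (letter ⟨ s ⟩) ⊗ n ⊗ letter β

  stopNβ↦ : ∀ {w N} → w ↦ N →
    (((alternating s ^ʷ k ++ side s) ++ β ∷ []) ++ w) ++ β ∷ [] ↦ P *ₘ S *ₘ B *ₘ N *ₘ B
  stopNβ↦ n = alternating↦ ⊗ letter ⟨ s ⟩ ⊗ letter β ⊗ n ⊗ letter β

  stopβ↦ : (alternating s ^ʷ k ++ side s) ++ β ∷ [] ↦ P *ₘ S *ₘ B
  stopβ↦ = alternating↦ ⊗ letter ⟨ s ⟩ ⊗ letter β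

-- The families with powers of AC or CA require a positive exponent, so `k = 0` falls to the
-- families without such a power. AB and CB themselves occur as the case of exponent 1 in `AᵏB` and
-- `CᵏB`.
form⇒H : ∀ {s w} → Form s w → ∃ λ M → w ↦ M × M ∈ H
form⇒H {α} (twiceNβ zero w)    = _ , power 2 (letter ⟨ α ⟩) ⊗ ↦-eval w ⊗ letter β , A²NB (eval∈G w)
form⇒H {α} (twiceNβ (suc k) w) = _ , twiceNβ↦ α (suc k) (↦-eval w) , [AC]ᵏA²NB {suc k} ℕ.z<s (eval∈G w)
form⇒H {α} (stopNβ zero w)     = _ , letter ⟨ α ⟩ ⊗ letter β ⊗ ↦-eval w ⊗ letter β , ABNB (eval∈G w)
form⇒H {α} (stopNβ (suc k) w)  = _ , stopNβ↦ α (suc k) (↦-eval w) , [AC]ᵏABNB {suc k} ℕ.z<s (eval∈G w)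
form⇒H {α} (stopβ zero)        = _ , power 1 (letter ⟨ α ⟩) ⊗ letter β , AᵏB {1} ℕ.z<s
form⇒H {α} (stopβ (suc k))     = _ , stopβ↦ α (suc k) , [AC]ᵏAB {suc k} ℕ.z<s
form⇒H {γ} (twiceNβ zero w)    = _ , power 2 (letter ⟨ γ ⟩) ⊗ ↦-eval w ⊗ letter β , C²NB (eval∈G w)
form⇒H {γ} (twiceNβ (suc k) w) = _ , twiceNβ↦ γ (suc k) (↦-eval w) , [CA]ᵏC²NB {suc k} ℕ.z<s (eval∈G w)
form⇒H {γ} (stopNβ zero w)     = _ , letter ⟨ γ ⟩ ⊗ letter β ⊗ ↦-eval w ⊗ letter β , CBNB (eval∈G w)
form⇒H {γ} (stopNβ (suc k) w)  = _ , stopNβ↦ γ (suc k) (↦-eval w) , [CA]ᵏCBNB {suc k} ℕ.z<s (eval∈G w)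
form⇒H {γ} (stopβ zero)        = _ , power 1 (letter ⟨ γ ⟩) ⊗ letter β , CᵏB {1} ℕ.z<s
form⇒H {γ} (stopβ (suc k))     = _ , stopβ↦ γ (suc k) , [CA]ᵏCB {suc k} ℕ.z<s

H⇒form : ∀ {M} → M ∈ H → ∃ λ s → ∃ λ w → Form s w × w ↦ M
H⇒form (A²NB n) with G⇒word n
... | w , w↦ = α , _ , twiceNβ 0 w , power 2 (letter ⟨ α ⟩) ⊗ w↦ ⊗ letter β
H⇒form (ABNB n) with G⇒word n
... | w , w↦ = α , _ , stopNβ 0 w , letter ⟨ α ⟩ ⊗ letter β ⊗ w↦ ⊗ letter β
H⇒form (AᵏB {suc zero} _)    = α , _ , stopβ 0 , power 1 (letter ⟨ α ⟩) ⊗ letter β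
-- From exponent 2 on, this family is contained in `A²NB`, with a power of A as `N`.
H⇒form (AᵏB {suc (suc k)} _) =
  α , _ , twiceNβ 0 (side α ^ʷ k) , power (2 ℕ.+ k) (letter ⟨ α ⟩) ⊗ letter β
H⇒form (C²NB n) with G⇒word n
... | w , w↦ = γ , _ , twiceNβ 0 w , power 2 (letter ⟨ γ ⟩) ⊗ w↦ ⊗ letter β
H⇒form (CBNB n) with G⇒word n
... | w , w↦ = γ , _ , stopNβ 0 w , letter ⟨ γ ⟩ ⊗ letter β ⊗ w↦ ⊗ letter β
H⇒form (CᵏB {suc zero} _)    = γ , _ , stopβ 0 , power 1 (letter ⟨ γ ⟩) ⊗ letter β
H⇒form (CᵏB {suc (suc k)} _) =
  γ , _ , twiceNβ 0 (side γ ^ʷ k) , power (2 ℕ.+ k) (letter ⟨ γ ⟩) ⊗ letter β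
H⇒form ([AC]ᵏA²NB {k} _ n) with G⇒word n
... | w , w↦ = α , _ , twiceNβ k w , twiceNβ↦ α k w↦
H⇒form ([AC]ᵏABNB {k} _ n) with G⇒word n
... | w , w↦ = α , _ , stopNβ k w , stopNβ↦ α k w↦
H⇒form ([AC]ᵏAB {k} _)     = α , _ , stopβ k , stopβ↦ α k
H⇒form ([CA]ᵏC²NB {k} _ n) with G⇒word n
... | w , w↦ = γ , _ , twiceNβ k w , twiceNβ↦ γ k w↦
H⇒form ([CA]ᵏCBNB {k} _ n) with G⇒word n
... | w , w↦ = γ , _ , stopNβ k w , stopNβ↦ γ k w↦
H⇒form ([CA]ᵏCB {k} _)     = γ , _ , stopβ k , stopβ↦ γ k

eval∈H′ : ∀ {w} → HWord′ w → eval w ∈ H′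
eval∈H′ (inj₁ (hword e _ h)) = inj₁ (in-H (form⇒H (parse e h)))
  where
  in-H : ∀ {w} → (∃ λ M → w ↦ M × M ∈ H) → eval w ∈ H
  in-H (_ , evaluates refl , m) = m
eval∈H′ (inj₂ refl)          = inj₂ refl

H′⇒hword′ : ∀ {M} → M ∈ H′ → ∃ λ w → HWord′ w × eval w ≡ M
H′⇒hword′ (inj₁ h) with H⇒form h
... | _ , w , f , evaluates eq = w , inj₁ (form⇒hword f) , eq
H′⇒hword′ (inj₂ refl) = [] , inj₂ refl , refl

-- Berggren's tree

Pos : ℤ → Set
Pos i = 0ℤ < i

infixl 6 _⊕_
infixl 7 _⊛_

_⊕_ : ∀ {i j} → Pos i → Pos j → Pos (i + j)
_⊕_ = ℤ.+-mono-<

_⊛_ : ∀ {i j} → Pos i → Pos j → Pos (i * j)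
_⊛_ (+<+ {n = suc _} _) (+<+ {n = suc _} _) = +<+ ℕ.z<s

pos-cancel : ∀ {i j} → Pos j → Pos (i * j) → Pos i
pos-cancel (+<+ {n = suc n} _) = ℤ.*-cancelʳ-<-nonNeg (+ suc n)

by : ∀ {i j} → i ≡ j → Pos i → Pos j
by = subst Pos

pos≢0 : ∀ {i} → Pos i → ¬ (i ≡ 0ℤ)
pos≢0 (+<+ ()) refl

pos-neg : ∀ {i} → i < 0ℤ → Pos (- i)
pos-neg = ℤ.neg-mono-<

square-nonNegative : ∀ i → 0ℤ ≤ i * i
square-nonNegative (+ zero)   = +≤+ z≤n
square-nonNegative (+ suc n)  = +≤+ z≤n
square-nonNegative -[1+ n ]   = +≤+ z≤n

<⇒pos : ∀ {i j} → i < j → Pos (j - i)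
<⇒pos {i} {j} i<j = subst (_< j - i) (ℤ.+-inverseʳ i) (ℤ.+-monoˡ-< (- i) i<j)

pos⇒< : ∀ {i j} → Pos (j - i) → i < j
pos⇒< {i} {j} p = ≡.subst₂ _<_ (ℤ.+-identityˡ i) (minus-plus j i) (ℤ.+-monoˡ-< i p)
  where
  minus-plus : ∀ j i → j - i + i ≡ j
  minus-plus = solve-∀

data Positive : Triple → Set where
  positive : ∀ {x y z} → Pos x → Pos y → Pos z → Positive (x ∷ y ∷ z ∷ [])

-- These consequences of 0 < x, 0 < y, 0 < z and x² + y² = z² are linear and already
-- preserved by A, B and C.
data Cone : Triple → Set where
  cone : ∀ {x y z} → Pos x → Pos y → Pos (z - x) → Pos (z - y) → Cone (x ∷ y ∷ z ∷ [])

cone⇒positive : ∀ {v} → Cone v → Positive v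
cone⇒positive (cone {x} {y} {z} px py pzx pzy) = positive px py (by (e x z) (pzx ⊕ px))
  where
  e : ∀ x z → (z - x) + x ≡ z
  e = solve-∀

-- Each of the four new quantities is a sum of copies of `x`, `y`, `z - x` and `z - y`.
cone-mat : ∀ ℓ {v} → Cone v → Cone (mat ℓ *ᵥ v)
cone-mat ⟨ α ⟩ (cone {x} {y} {z} px py zx zy) =
  cone (by (e₁ x y z) (px ⊕ zy ⊕ zy)) (by (e₂ x y z) (px ⊕ px ⊕ px ⊕ zx ⊕ zy))
       (by (e₃ x y z) (px ⊕ px ⊕ zx)) (by (e₄ x y z) zy)
  where
  e₁ : ∀ x y z → x + (z - y) + (z - y) ≡ + 1 * x + (- + 2 * y + (+ 2 * z + 0ℤ))
  e₁ = solve-∀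
  e₂ : ∀ x y z → x + x + x + (z - x) + (z - y) ≡ + 2 * x + (- + 1 * y + (+ 2 * z + 0ℤ))
  e₂ = solve-∀
  e₃ : ∀ x y z → x + x + (z - x) ≡
       (+ 2 * x + (- + 2 * y + (+ 3 * z + 0ℤ))) - (+ 1 * x + (- + 2 * y + (+ 2 * z + 0ℤ)))
  e₃ = solve-∀
  e₄ : ∀ x y z → z - y ≡
       (+ 2 * x + (- + 2 * y + (+ 3 * z + 0ℤ))) - (+ 2 * x + (- + 1 * y + (+ 2 * z + 0ℤ)))
  e₄ = solve-∀
cone-mat β (cone {x} {y} {z} px py zx zy) =
  cone (by (e₁ x y z) (px ⊕ px ⊕ px ⊕ py ⊕ py ⊕ zx ⊕ zx))
       (by (e₂ x y z) (px ⊕ px ⊕ py ⊕ py ⊕ py ⊕ zy ⊕ zy))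
       (by (e₃ x y z) (px ⊕ px ⊕ zx)) (by (e₄ x y z) (py ⊕ py ⊕ zy))
  where
  e₁ : ∀ x y z → x + x + x + y + y + (z - x) + (z - x) ≡ + 1 * x + (+ 2 * y + (+ 2 * z + 0ℤ))
  e₁ = solve-∀
  e₂ : ∀ x y z → x + x + y + y + y + (z - y) + (z - y) ≡ + 2 * x + (+ 1 * y + (+ 2 * z + 0ℤ))
  e₂ = solve-∀
  e₃ : ∀ x y z → x + x + (z - x) ≡
       (+ 2 * x + (+ 2 * y + (+ 3 * z + 0ℤ))) - (+ 1 * x + (+ 2 * y + (+ 2 * z + 0ℤ)))
  e₃ = solve-∀
  e₄ : ∀ x y z → y + y + (z - y) ≡
       (+ 2 * x + (+ 2 * y + (+ 3 * z + 0ℤ))) - (+ 2 * x + (+ 1 * y + (+ 2 * z + 0ℤ)))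
  e₄ = solve-∀
cone-mat ⟨ γ ⟩ (cone {x} {y} {z} px py zx zy) =
  cone (by (e₁ x y z) (py ⊕ py ⊕ py ⊕ zy ⊕ zx)) (by (e₂ x y z) (py ⊕ zx ⊕ zx))
       (by (e₃ x y z) zx) (by (e₄ x y z) (py ⊕ py ⊕ zy))
  where
  e₁ : ∀ x y z → y + y + y + (z - y) + (z - x) ≡ - + 1 * x + (+ 2 * y + (+ 2 * z + 0ℤ))
  e₁ = solve-∀
  e₂ : ∀ x y z → y + (z - x) + (z - x) ≡ - + 2 * x + (+ 1 * y + (+ 2 * z + 0ℤ))
  e₂ = solve-∀
  e₃ : ∀ x y z → z - x ≡
       (- + 2 * x + (+ 2 * y + (+ 3 * z + 0ℤ))) - (- + 1 * x + (+ 2 * y + (+ 2 * z + 0ℤ)))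
  e₃ = solve-∀
  e₄ : ∀ x y z → y + y + (z - y) ≡
       (- + 2 * x + (+ 2 * y + (+ 3 * z + 0ℤ))) - (- + 2 * x + (+ 1 * y + (+ 2 * z + 0ℤ)))
  e₄ = solve-∀

-- Triples of words, and thinness read off the alternating prefix

triple : Word → Triple
triple []      = root
triple (ℓ ∷ w) = mat ℓ *ᵥ triple w

eval-root : ∀ w → eval w *ᵥ root ≡ triple w
eval-root []      = refl
eval-root (ℓ ∷ w) = trans (*ᵥ-assoc (mat ℓ) (eval w) root) (cong (mat ℓ *ᵥ_) (eval-root w))

cone-triple : ∀ {w} → EndsInβ w → Cone (triple w)
-- The root has a zero leg and lies outside the cone; induction starts at its image (3, 4, 5) under
-- B.
cone-triple [β]     = cone (+<+ ℕ.z<s) (+<+ ℕ.z<s) (+<+ ℕ.z<s) (+<+ ℕ.z<s)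
cone-triple (ℓ ∷ e) = cone-mat ℓ (cone-triple e)

-- Positive slack is thinness in one leg: x for α, y for γ. The weight is the amount by which the
-- slack of the opposite side is negative after a letter `⟨ s ⟩` or β.
slack weight : Side → Triple → ℤ
slack α (x ∷ y ∷ z ∷ []) = z - (x + x)
slack γ (x ∷ y ∷ z ∷ []) = z - (y + y)
weight α (x ∷ y ∷ z ∷ []) = x + x + z
weight γ (x ∷ y ∷ z ∷ []) = y + y + z

weight-root : ∀ s → Pos (weight s root)
weight-root α = +<+ ℕ.z<s
weight-root γ = +<+ ℕ.z<s

weight-positive : ∀ s {v} → Positive v → Pos (weight s v)
weight-positive α (positive px py pz) = px ⊕ px ⊕ pz
weight-positive γ (positive px py pz) = py ⊕ py ⊕ pz

slack-same : ∀ s v → slack s (mat ⟨ s ⟩ *ᵥ v) ≡ - slack (opp s) v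
slack-same α (x ∷ y ∷ z ∷ []) = e x y z
  where
  e : ∀ x y z →
      let x′ = + 1 * x + (- + 2 * y + (+ 2 * z + 0ℤ))
          z′ = + 2 * x + (- + 2 * y + (+ 3 * z + 0ℤ))
      in z′ - (x′ + x′) ≡ - (z - (y + y))
  e = solve-∀
slack-same γ (x ∷ y ∷ z ∷ []) = e x y z
  where
  e : ∀ x y z →
      let y′ = - + 2 * x + (+ 1 * y + (+ 2 * z + 0ℤ))
          z′ = - + 2 * x + (+ 2 * y + (+ 3 * z + 0ℤ))
      in z′ - (y′ + y′) ≡ - (z - (x + x))
  e = solve-∀

slack-opp : ∀ s v → slack (opp s) (mat ⟨ s ⟩ *ᵥ v) ≡ - weight s v
slack-opp α (x ∷ y ∷ z ∷ []) = e x y z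
  where
  e : ∀ x y z →
      let y′ = + 2 * x + (- + 1 * y + (+ 2 * z + 0ℤ))
          z′ = + 2 * x + (- + 2 * y + (+ 3 * z + 0ℤ))
      in z′ - (y′ + y′) ≡ - (x + x + z)
  e = solve-∀
slack-opp γ (x ∷ y ∷ z ∷ []) = e x y z
  where
  e : ∀ x y z →
      let x′ = - + 1 * x + (+ 2 * y + (+ 2 * z + 0ℤ))
          z′ = - + 2 * x + (+ 2 * y + (+ 3 * z + 0ℤ))
      in z′ - (x′ + x′) ≡ - (y + y + z)
  e = solve-∀

slack-β : ∀ s v → slack (opp s) (B *ᵥ v) ≡ - weight s v
slack-β α (x ∷ y ∷ z ∷ []) = e x y z
  where
  e : ∀ x y z →
      let y′ = + 2 * x + (+ 1 * y + (+ 2 * z + 0ℤ))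
          z′ = + 2 * x + (+ 2 * y + (+ 3 * z + 0ℤ))
      in z′ - (y′ + y′) ≡ - (x + x + z)
  e = solve-∀
slack-β γ (x ∷ y ∷ z ∷ []) = e x y z
  where
  e : ∀ x y z →
      let x′ = + 1 * x + (+ 2 * y + (+ 2 * z + 0ℤ))
          z′ = + 2 * x + (+ 2 * y + (+ 3 * z + 0ℤ))
      in z′ - (x′ + x′) ≡ - (y + y + z)
  e = solve-∀

slack-of-same : ∀ s v {t} → slack (opp s) v ≡ - t → slack s (mat ⟨ s ⟩ *ᵥ v) ≡ t
slack-of-same s v {t} eq = trans (slack-same s v) (trans (cong -_ eq) (ℤ.neg-involutive t))

opp-involutive : ∀ s → opp (opp s) ≡ s
opp-involutive α = refl
opp-involutive γ = refl

-- Each letter exchanges the two slacks up to sign, and the two signs cancel.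
slack-alt : ∀ s v → slack s (mat ⟨ s ⟩ *ᵥ mat ⟨ opp s ⟩ *ᵥ v) ≡ slack s v
slack-alt s v = slack-of-same s (mat ⟨ opp s ⟩ *ᵥ v)
  (trans (slack-same (opp s) v) (cong (λ t → - slack t v) (opp-involutive s)))

weight-triple : ∀ s {w} → EndsInβ w → Pos (weight s (triple w))
weight-triple s e = weight-positive s (cone⇒positive (cone-triple e))

-- What follows a β may be empty, and then its triple is the root, which is not `Positive` but still
-- has positive weights.
weight-tail : ∀ s {w} → EndsInβ (β ∷ w) → Pos (weight s (triple w))
weight-tail s [β]     = weight-root s
weight-tail s (_ ∷ e) = weight-triple s e

head⇒slack : ∀ {s w} → EndsInβ w → Head s w → Pos (slack s (triple w))
head⇒slack {s} (_ ∷ _ ∷ e) (twice {w}) =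
  by (sym (slack-of-same s _ (slack-opp s (triple w)))) (weight-triple s e)
head⇒slack {s} (_ ∷ e) (stop {w}) =
  by (sym (slack-of-same s _ (slack-β s (triple w)))) (weight-tail s e)
head⇒slack {s} (_ ∷ _ ∷ e) (alt {w} h) =
  by (sym (slack-alt s (triple w))) (head⇒slack e h)

pos-asym : ∀ {i j} → Pos i → j ≡ - i → ¬ Pos j
pos-asym {i} p refl q = pos≢0 (p ⊕ q) (ℤ.+-inverseʳ i)

slack⇒head : ∀ s {w} → EndsInβ w → Pos (slack s (triple w)) → Head s w
-- A first letter β or one of the opposite side makes the slack minus a positive weight.
slack⇒head α {β ∷ w}     e       p = ⊥-elim (pos-asym (weight-tail γ e) (slack-β γ (triple w)) p)
slack⇒head γ {β ∷ w}     e       p = ⊥-elim (pos-asym (weight-tail α e) (slack-β α (triple w)) p)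
slack⇒head α {⟨ γ ⟩ ∷ w} (_ ∷ e) p = ⊥-elim (pos-asym (weight-triple γ e) (slack-opp γ (triple w)) p)
slack⇒head γ {⟨ α ⟩ ∷ w} (_ ∷ e) p = ⊥-elim (pos-asym (weight-triple α e) (slack-opp α (triple w)) p)
slack⇒head α {⟨ α ⟩ ∷ []}          (_ ∷ ())    p
slack⇒head γ {⟨ γ ⟩ ∷ []}          (_ ∷ ())    p
slack⇒head α {⟨ α ⟩ ∷ β ∷ w}     e           p = stop
slack⇒head α {⟨ α ⟩ ∷ ⟨ α ⟩ ∷ w} e           p = twice
slack⇒head α {⟨ α ⟩ ∷ ⟨ γ ⟩ ∷ w} (_ ∷ _ ∷ e) p = alt (slack⇒head α e (by (slack-alt α (triple w)) p))
slack⇒head γ {⟨ γ ⟩ ∷ β ∷ w}     e           p = stop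
slack⇒head γ {⟨ γ ⟩ ∷ ⟨ γ ⟩ ∷ w} e           p = twice
slack⇒head γ {⟨ γ ⟩ ∷ ⟨ α ⟩ ∷ w} (_ ∷ _ ∷ e) p = alt (slack⇒head γ e (by (slack-alt γ (triple w)) p))

-- Inverse matrices and invariants

inverse : Letter → Matrix
inverse ⟨ α ⟩ = (+ 1 ∷ + 2 ∷ - + 2 ∷ []) ∷ (- + 2 ∷ - + 1 ∷ + 2 ∷ []) ∷ (- + 2 ∷ - + 2 ∷ + 3 ∷ []) ∷ []
inverse β     = (+ 1 ∷ + 2 ∷ - + 2 ∷ []) ∷ (+ 2 ∷ + 1 ∷ - + 2 ∷ []) ∷ (- + 2 ∷ - + 2 ∷ + 3 ∷ []) ∷ []
inverse ⟨ γ ⟩ = (- + 1 ∷ - + 2 ∷ + 2 ∷ []) ∷ (+ 2 ∷ + 1 ∷ - + 2 ∷ []) ∷ (- + 2 ∷ - + 2 ∷ + 3 ∷ []) ∷ []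

inverseˡ : ∀ ℓ → inverse ℓ *ₘ mat ℓ ≡ I₃
inverseˡ ⟨ α ⟩ = refl
inverseˡ ⟨ γ ⟩ = refl
inverseˡ β     = refl

inverseʳ : ∀ ℓ → mat ℓ *ₘ inverse ℓ ≡ I₃
inverseʳ ⟨ α ⟩ = refl
inverseʳ ⟨ γ ⟩ = refl
inverseʳ β     = refl

*ᵥ-cancel : ∀ M N → M *ₘ N ≡ I₃ → ∀ v → M *ᵥ N *ᵥ v ≡ v
*ᵥ-cancel M N eq v = trans (sym (*ᵥ-assoc M N v)) (trans (cong (_*ᵥ v) eq) (I₃-*ᵥ v))

inverse-mat : ∀ ℓ v → inverse ℓ *ᵥ mat ℓ *ᵥ v ≡ v
inverse-mat ℓ = *ᵥ-cancel (inverse ℓ) (mat ℓ) (inverseˡ ℓ)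

mat-inverse : ∀ ℓ v → mat ℓ *ᵥ inverse ℓ *ᵥ v ≡ v
mat-inverse ℓ = *ᵥ-cancel (mat ℓ) (inverse ℓ) (inverseʳ ℓ)

-- The Lorentz form, whose null vectors are the Pythagorean triples.
norm : Triple → ℤ
norm (x ∷ y ∷ z ∷ []) = x * x + y * y - z * z

norm-mat : ∀ ℓ v → norm (mat ℓ *ᵥ v) ≡ norm v
norm-mat ⟨ α ⟩ (x ∷ y ∷ z ∷ []) = e x y z
  where
  e : ∀ x y z →
      let x′ = + 1 * x + (- + 2 * y + (+ 2 * z + 0ℤ))
          y′ = + 2 * x + (- + 1 * y + (+ 2 * z + 0ℤ))
          z′ = + 2 * x + (- + 2 * y + (+ 3 * z + 0ℤ))
      in x′ * x′ + y′ * y′ - z′ * z′ ≡ x * x + y * y - z * z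
  e = solve-∀
norm-mat β (x ∷ y ∷ z ∷ []) = e x y z
  where
  e : ∀ x y z →
      let x′ = + 1 * x + (+ 2 * y + (+ 2 * z + 0ℤ))
          y′ = + 2 * x + (+ 1 * y + (+ 2 * z + 0ℤ))
          z′ = + 2 * x + (+ 2 * y + (+ 3 * z + 0ℤ))
      in x′ * x′ + y′ * y′ - z′ * z′ ≡ x * x + y * y - z * z
  e = solve-∀
norm-mat ⟨ γ ⟩ (x ∷ y ∷ z ∷ []) = e x y z
  where
  e : ∀ x y z →
      let x′ = - + 1 * x + (+ 2 * y + (+ 2 * z + 0ℤ))
          y′ = - + 2 * x + (+ 1 * y + (+ 2 * z + 0ℤ))
          z′ = - + 2 * x + (+ 2 * y + (+ 3 * z + 0ℤ))
      in x′ * x′ + y′ * y′ - z′ * z′ ≡ x * x + y * y - z * z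
  e = solve-∀

norm-inverse : ∀ ℓ v → norm (inverse ℓ *ᵥ v) ≡ norm v
norm-inverse ℓ v = trans (sym (norm-mat ℓ (inverse ℓ *ᵥ v))) (cong norm (mat-inverse ℓ v))

infix 4 _∣ᵥ_
data _∣ᵥ_ (d : ℤ) : Triple → Set where
  divides-all : ∀ {x y z} → d ∣ x → d ∣ y → d ∣ z → d ∣ᵥ x ∷ y ∷ z ∷ []

∣0 : ∀ {d} → d ∣ 0ℤ
∣0 = divides 0ℤ refl

∣ᵥ-*ᵥ : ∀ {d} M {v} → d ∣ᵥ v → d ∣ᵥ M *ᵥ v
∣ᵥ-*ᵥ {d} (r₁ ∷ r₂ ∷ r₃ ∷ []) (divides-all {x} {y} {z} dx dy dz) = divides-all (row r₁) (row r₂) (row r₃)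
  where
  row : ∀ r → d ∣ r · (x ∷ y ∷ z ∷ [])
  row (a ∷ b ∷ c ∷ []) =
    ∣m∣n⇒∣m+n (∣n⇒∣m*n a dx) (∣m∣n⇒∣m+n (∣n⇒∣m*n b dy) (∣m∣n⇒∣m+n (∣n⇒∣m*n c dz) ∣0))

-- Coprimality stated through common divisors instead of `gcd`: in this form it passes along any
-- integer matrix with an integer left inverse.
Primitive : Triple → Set
Primitive v = ∀ {d} → d ∣ᵥ v → d ∣ 1ℤ

primitive-*ᵥ : ∀ M N {v} → N *ₘ M ≡ I₃ → Primitive v → Primitive (M *ᵥ v)
primitive-*ᵥ M N {v} eq prim {d} d∣ = prim (subst (d ∣ᵥ_) (*ᵥ-cancel N M eq v) (∣ᵥ-*ᵥ N d∣))

EvenLeg : Triple → Set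
EvenLeg (x ∷ y ∷ z ∷ []) = + 2 ∣ y

-- The middle rows of A, B, C and of their inverses have even outer entries, so the parity of the
-- second leg is preserved.
evenRow : ∀ {a c} b {x y z} → + 2 ∣ a → + 2 ∣ c → + 2 ∣ y →
          + 2 ∣ (a ∷ b ∷ c ∷ []) · (x ∷ y ∷ z ∷ [])
evenRow b {x} {y} {z} 2a 2c 2y =
  ∣m∣n⇒∣m+n (∣m⇒∣m*n x 2a) (∣m∣n⇒∣m+n (∣n⇒∣m*n b 2y) (∣m∣n⇒∣m+n (∣m⇒∣m*n z 2c) ∣0))

2∣2 : + 2 ∣ + 2
2∣2 = divides 1ℤ refl

2∣-2 : + 2 ∣ - + 2
2∣-2 = divides (- 1ℤ) refl

-- The conditions of `𝔓` apart from signs. They are preserved in both directions of the tree and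
-- hold at the root as well.
record Good (v : Triple) : Set where
  constructor good
  field
    even  : EvenLeg v
    prim  : Primitive v
    norm0 : norm v ≡ 0ℤ

good-mat : ∀ ℓ {v} → Good v → Good (mat ℓ *ᵥ v)
good-mat ℓ {v} (good even prim norm0) =
  good (even-mat ℓ v even) (primitive-*ᵥ (mat ℓ) (inverse ℓ) (inverseˡ ℓ) prim) (trans (norm-mat ℓ v) norm0)
  where
  even-mat : ∀ ℓ v → EvenLeg v → EvenLeg (mat ℓ *ᵥ v)
  even-mat ⟨ α ⟩ (x ∷ y ∷ z ∷ []) = evenRow (- + 1) {x} {y} {z} 2∣2 2∣2
  even-mat β     (x ∷ y ∷ z ∷ []) = evenRow (+ 1) {x} {y} {z} 2∣2 2∣2
  even-mat ⟨ γ ⟩ (x ∷ y ∷ z ∷ []) = evenRow (+ 1) {x} {y} {z} 2∣-2 2∣2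

good-inverse : ∀ ℓ {v} → Good v → Good (inverse ℓ *ᵥ v)
good-inverse ℓ {v} (good even prim norm0) =
  good (even-inverse ℓ v even) (primitive-*ᵥ (inverse ℓ) (mat ℓ) (inverseʳ ℓ) prim) (trans (norm-inverse ℓ v) norm0)
  where
  even-inverse : ∀ ℓ v → EvenLeg v → EvenLeg (inverse ℓ *ᵥ v)
  even-inverse ⟨ α ⟩ (x ∷ y ∷ z ∷ []) = evenRow (- + 1) {x} {y} {z} 2∣-2 2∣2
  even-inverse β     (x ∷ y ∷ z ∷ []) = evenRow (+ 1) {x} {y} {z} 2∣2 2∣-2
  even-inverse ⟨ γ ⟩ (x ∷ y ∷ z ∷ []) = evenRow (+ 1) {x} {y} {z} 2∣2 2∣-2

good-triple : ∀ w → Good (triple w)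
good-triple []      = good (divides 0ℤ refl) (λ { (divides-all d∣1 _ _) → d∣1 }) refl
good-triple (ℓ ∷ w) = good-mat ℓ (good-triple w)

-- The sign patterns of the first two coordinates of B⁻¹v that reveal the first letter. The sector
-- of β allows `q = 0` because B⁻¹ sends (3, 4, 5) to the root.
data Sector : Letter → Triple → Set where
  sector-α : ∀ {p q r} → Pos p → Pos (- q) → Sector ⟨ α ⟩ (p ∷ q ∷ r ∷ [])
  sector-β : ∀ {p q r} → Pos p → 0ℤ ≤ q → Sector β (p ∷ q ∷ r ∷ [])
  sector-γ : ∀ {p q r} → Pos (- p) → Sector ⟨ γ ⟩ (p ∷ q ∷ r ∷ [])

pos-neg-absurd : ∀ {i} → Pos i → ¬ Pos (- i)
pos-neg-absurd p = pos-asym p refl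

nonNegative-neg-absurd : ∀ {i} → 0ℤ ≤ i → ¬ Pos (- i)
nonNegative-neg-absurd {+ zero} _ (+<+ ())
nonNegative-neg-absurd {+ suc _} _ ()

sector-unique : ∀ {ℓ ℓ′ v} → Sector ℓ v → Sector ℓ′ v → ℓ ≡ ℓ′
sector-unique (sector-α _ _) (sector-α _ _) = refl
sector-unique (sector-α _ q) (sector-β _ q′) = ⊥-elim (nonNegative-neg-absurd q′ q)
sector-unique (sector-α p _) (sector-γ p′)   = ⊥-elim (pos-neg-absurd p p′)
sector-unique (sector-β _ q) (sector-α _ q′) = ⊥-elim (nonNegative-neg-absurd q q′)
sector-unique (sector-β _ _) (sector-β _ _) = refl
sector-unique (sector-β p _) (sector-γ p′)   = ⊥-elim (pos-neg-absurd p p′)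
sector-unique (sector-γ p) (sector-α p′ _)   = ⊥-elim (pos-neg-absurd p′ p)
sector-unique (sector-γ p) (sector-β p′ _)   = ⊥-elim (pos-neg-absurd p′ p)
sector-unique (sector-γ _) (sector-γ _)      = refl

-- B⁻¹A negates the second coordinate and B⁻¹C the first.
sector-mat : ∀ ℓ {v} → Positive v → Sector ℓ (inverse β *ᵥ mat ℓ *ᵥ v)
sector-mat ⟨ α ⟩ (positive {x} {y} {z} px py pz) = sector-α (by (e₁ x y z) px) (by (e₂ x y z) py)
  where
  e₁ : ∀ x y z →
      let x′ = + 1 * x + (- + 2 * y + (+ 2 * z + 0ℤ))
          y′ = + 2 * x + (- + 1 * y + (+ 2 * z + 0ℤ))
          z′ = + 2 * x + (- + 2 * y + (+ 3 * z + 0ℤ))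
      in x ≡ + 1 * x′ + (+ 2 * y′ + (- + 2 * z′ + 0ℤ))
  e₁ = solve-∀
  e₂ : ∀ x y z →
      let x′ = + 1 * x + (- + 2 * y + (+ 2 * z + 0ℤ))
          y′ = + 2 * x + (- + 1 * y + (+ 2 * z + 0ℤ))
          z′ = + 2 * x + (- + 2 * y + (+ 3 * z + 0ℤ))
      in y ≡ - (+ 2 * x′ + (+ 1 * y′ + (- + 2 * z′ + 0ℤ)))
  e₂ = solve-∀
sector-mat β {v} pv = subst (Sector β) (sym (inverse-mat β v)) (in-sector pv)
  where
  in-sector : ∀ {v} → Positive v → Sector β v
  in-sector (positive px py pz) = sector-β px (ℤ.<⇒≤ py)
sector-mat ⟨ γ ⟩ (positive {x} {y} {z} px py pz) = sector-γ (by (e x y z) px)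
  where
  e : ∀ x y z →
      let x′ = - + 1 * x + (+ 2 * y + (+ 2 * z + 0ℤ))
          y′ = - + 2 * x + (+ 1 * y + (+ 2 * z + 0ℤ))
          z′ = - + 2 * x + (+ 2 * y + (+ 3 * z + 0ℤ))
      in x ≡ - (+ 1 * x′ + (+ 2 * y′ + (- + 2 * z′ + 0ℤ)))
  e = solve-∀

positive-triple : ∀ {w} → EndsInβ w → Positive (triple w)
positive-triple = cone⇒positive ∘ cone-triple

sector-triple : ∀ {ℓ w} → EndsInβ (ℓ ∷ w) → Sector ℓ (inverse β *ᵥ triple (ℓ ∷ w))
sector-triple [β]     = sector-β (+<+ ℕ.z<s) (+≤+ z≤n)
sector-triple (ℓ ∷ e) = sector-mat ℓ (positive-triple e)

root≢triple : ∀ {w} → EndsInβ w → ¬ (root ≡ triple w)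
root≢triple e eq with subst Positive (sym eq) (positive-triple e)
... | positive _ (+<+ ()) _

mat-injective : ∀ ℓ {u v} → mat ℓ *ᵥ u ≡ mat ℓ *ᵥ v → u ≡ v
mat-injective ℓ {u} {v} eq = trans (sym (inverse-mat ℓ u))
  (trans (cong (inverse ℓ *ᵥ_) eq) (inverse-mat ℓ v))

head-letter : ∀ {ℓ ℓ′ w w′} → EndsInβ (ℓ ∷ w) → EndsInβ (ℓ′ ∷ w′) →
              triple (ℓ ∷ w) ≡ triple (ℓ′ ∷ w′) → ℓ ≡ ℓ′
head-letter e e′ eq =
  sector-unique (sector-triple e) (subst (Sector _ ∘ (inverse β *ᵥ_)) (sym eq) (sector-triple e′))

-- The sector determines the first letter, which is then removed by its inverse. A word cannot stop
-- before the other one, as the root is not the triple of a word ending in β.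
triple-injective : ∀ {w w′} → EndsInβ w → EndsInβ w′ → triple w ≡ triple w′ → w ≡ w′
triple-injective {ℓ ∷ w} {ℓ′ ∷ w′} e e′ eq with head-letter e e′ eq
triple-injective [β]      [β]       eq | refl = refl
triple-injective [β]      (_ ∷ e′)  eq | refl = ⊥-elim (root≢triple e′ (mat-injective β eq))
triple-injective (_ ∷ e)  [β]       eq | refl = ⊥-elim (root≢triple e (sym (mat-injective β eq)))
triple-injective (ℓ ∷ e)  (_ ∷ e′)  eq | refl = cong (ℓ ∷_) (triple-injective e e′ (mat-injective ℓ eq))

triple-injective′ : ∀ {w w′} → HWord′ w → HWord′ w′ → triple w ≡ triple w′ → w ≡ w′
triple-injective′ (inj₁ h)    (inj₁ h′)    eq = triple-injective (HWord.endsInβ h) (HWord.endsInβ h′) eq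
triple-injective′ (inj₁ h)    (inj₂ refl)  eq = ⊥-elim (root≢triple (HWord.endsInβ h) (sym eq))
triple-injective′ (inj₂ refl) (inj₁ h)     eq = ⊥-elim (root≢triple (HWord.endsInβ h) eq)
triple-injective′ (inj₂ refl) (inj₂ refl)  eq = refl

-- Descent from a primitive triple to (3, 4, 5)

zero-right : ∀ {i j} → Pos i → i * j ≡ 0ℤ → j ≡ 0ℤ
zero-right {i} p eq with ℤ.i*j≡0⇒i≡0∨j≡0 i eq
... | inj₁ i≡0 = ⊥-elim (pos≢0 p i≡0)
... | inj₂ j≡0 = j≡0

2∤1 : ¬ (+ 2 ∣ 1ℤ)
2∤1 2∣1 with ℕ.∣1⇒≡1 (∣⇒∣ᵤ 2∣1)
... | ()

-- p, q, r are the coordinates of B⁻¹ v; A⁻¹ v and C⁻¹ v differ from it in the sign of q and p.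
module Descent {x y z : ℤ} (px : Pos x) (py : Pos y) (pz : Pos z)
               (isGood : Good (x ∷ y ∷ z ∷ [])) where
  open Good isGood

  private
    v : Triple
    v = x ∷ y ∷ z ∷ []

    p q r : ℤ
    p = + 1 * x + (+ 2 * y + (- + 2 * z + 0ℤ))
    q = + 2 * x + (+ 1 * y + (- + 2 * z + 0ℤ))
    r = - + 2 * x + (- + 2 * y + (+ 3 * z + 0ℤ))

  -- Computation modulo a relation `n ≡ 0ℤ`: with the multiple `k * n` written out, what remains is
  -- a polynomial identity for the ring solver.
  vanish : ∀ {i j n} k → i ≡ j + k * n → n ≡ 0ℤ → i ≡ j
  vanish {j = j} k eq refl = trans eq (trans (cong (λ i → j + i) (ℤ.*-zeroʳ k)) (ℤ.+-identityʳ j))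

  z-x-positive : Pos (z - x)
  z-x-positive = pos-cancel (pz ⊕ px) (by (vanish 1ℤ (e x y z) norm0) (py ⊛ py))
    where
    e : ∀ x y z → y * y ≡ (z - x) * (z + x) + 1ℤ * (x * x + y * y - z * z)
    e = solve-∀

  z-y-positive : Pos (z - y)
  z-y-positive = pos-cancel (pz ⊕ py) (by (vanish 1ℤ (e x y z) norm0) (px ⊛ px))
    where
    e : ∀ x y z → x * x ≡ (z - y) * (z + y) + 1ℤ * (x * x + y * y - z * z)
    e = solve-∀

  -- Here r = 3z - 2(x + y). Multiplied by 3z + 2(x + y) it becomes 9z² - 4(x + y)², which equals
  -- 4(x - y)² + x² + y² when z² = x² + y².
  r-positive : Pos r
  r-positive = pos-cancel (px ⊕ px ⊕ py ⊕ py ⊕ pz ⊕ pz ⊕ pz)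
    (by (vanish (+ 9) (e x y z) norm0)
        (ℤ.+-mono-≤-< (square-nonNegative (+ 2 * (x - y))) (px ⊛ px ⊕ py ⊛ py)))
    where
    e : ∀ x y z → + 2 * (x - y) * (+ 2 * (x - y)) + (x * x + y * y) ≡
        (- + 2 * x + (- + 2 * y + (+ 3 * z + 0ℤ))) * (x + x + y + y + z + z + z)
        + + 9 * (x * x + y * y - z * z)
    e = solve-∀

  -- The difference z - r is 2(x + y - z), and (x + y - z)(x + y + z) = 2xy.
  r<z : r < z
  r<z = pos⇒< (by (f x y z) (s ⊕ s))
    where
    e : ∀ x y z → x * y + x * y ≡ (x + y - z) * (x + y + z) + - 1ℤ * (x * x + y * y - z * z)
    e = solve-∀
    s : Pos (x + y - z)
    s = pos-cancel (px ⊕ py ⊕ pz) (by (vanish (- 1ℤ) (e x y z) norm0) (px ⊛ py ⊕ px ⊛ py))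
    f : ∀ x y z → (x + y - z) + (x + y - z) ≡ z - (- + 2 * x + (- + 2 * y + (+ 3 * z + 0ℤ)))
    f = solve-∀

  -- Let P = −p and Q = −q. Then y = 2r − 2P − Q and r² = P² + Q² give
  -- y (2r + 2P + Q) = Q (3Q − 4P); likewise x (2r + P + 2Q) = P (3P − 4Q). Weighted by
  -- P and Q, these two positive numbers add up to −PQ (P + Q).
  ¬both-negative : Pos (- p) → ¬ Pos (- q)
  ¬both-negative P Q = pos≢0
    (P ⊛ py ⊛ (R ⊕ R ⊕ P ⊕ P ⊕ Q) ⊕ Q ⊛ px ⊛ (R ⊕ R ⊕ P ⊕ Q ⊕ Q) ⊕ P ⊛ Q ⊛ (P ⊕ Q))
    (vanish (- + 4 * (- p + - q)) (e x y z) norm0)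
    where
    R : Pos r
    R = r-positive
    e : ∀ x y z →
      let P = - (+ 1 * x + (+ 2 * y + (- + 2 * z + 0ℤ)))
          Q = - (+ 2 * x + (+ 1 * y + (- + 2 * z + 0ℤ)))
          R = - + 2 * x + (- + 2 * y + (+ 3 * z + 0ℤ))
      in P * y * (R + R + P + P + Q) + Q * x * (R + R + P + Q + Q) + P * Q * (P + Q)
         ≡ 0ℤ + - + 4 * (P + Q) * (x * x + y * y - z * z)
    e = solve-∀

  -- If p = 0, then x = 2(z - y) and 3z = 5y, so the triple is proportional to (4, 3, 5). As y is
  -- even, all three coordinates are even, against primitivity.
  p≢0 : ¬ (p ≡ 0ℤ)
  p≢0 p≡0 = not-even even
    where
    e₁ : ∀ x y z → let p = + 1 * x + (+ 2 * y + (- + 2 * z + 0ℤ)) in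
         (z - y) * (+ 3 * z - + 5 * y) ≡ (x * x + y * y - z * z) + - (p + + 4 * (z - y)) * p
    e₁ = solve-∀
    e₂ : ∀ x y z → x ≡ (z - y) * + 2 + 1ℤ * (+ 1 * x + (+ 2 * y + (- + 2 * z + 0ℤ)))
    e₂ = solve-∀
    e₃ : ∀ y z k → z ≡ ((+ 5 * k - z) * + 2 + 1ℤ * (+ 3 * z - + 5 * y)) + + 5 * (y - k * + 2)
    e₃ = solve-∀
    t≡0 : + 3 * z - + 5 * y ≡ 0ℤ
    t≡0 = zero-right z-y-positive (trans (vanish (- (p + + 4 * (z - y))) (e₁ x y z) p≡0) norm0)
    not-even : ¬ (+ 2 ∣ y)
    not-even 2∣y@(divides k y≡) = 2∤1 (prim (divides-all
      (divides (z - y) (vanish 1ℤ (e₂ x y z) p≡0)) 2∣y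
      (divides (+ 5 * k - z) (vanish 1ℤ (vanish (+ 5) (e₃ y z k) (ℤ.i≡j⇒i-j≡0 y≡)) t≡0))))

  q≡0⇒345 : q ≡ 0ℤ → v ≡ triple (β ∷ [])
  q≡0⇒345 q≡0 = trans (cong₃ x≡ y≡ z≡) (cong (λ d → + 3 * d ∷ + 4 * d ∷ + 5 * d ∷ []) d≡1)
    where
    d t : ℤ
    -- On a multiple (3m, 4m, 5m) of (3, 4, 5) this value is m, the common divisor that primitivity
    -- forces to be 1.
    d = x + x - z
    t = + 3 * z - + 5 * x
    e₁ : ∀ x y z → let q = + 2 * x + (+ 1 * y + (- + 2 * z + 0ℤ)) in
         (z - x) * (+ 3 * z - + 5 * x) ≡ (x * x + y * y - z * z) + - (q + + 4 * (z - x)) * q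
    e₁ = solve-∀
    t≡0 : t ≡ 0ℤ
    t≡0 = zero-right z-x-positive (trans (vanish (- (q + + 4 * (z - x))) (e₁ x y z) q≡0) norm0)
    e₂ : ∀ x z → x ≡ + 3 * (x + x - z) + 1ℤ * (+ 3 * z - + 5 * x)
    e₂ = solve-∀
    e₃ : ∀ x y z → y ≡
         (+ 4 * (x + x - z) + + 2 * (+ 3 * z - + 5 * x)) + 1ℤ * (+ 2 * x + (+ 1 * y + (- + 2 * z + 0ℤ)))
    e₃ = solve-∀
    e₄ : ∀ x z → z ≡ + 5 * (x + x - z) + + 2 * (+ 3 * z - + 5 * x)
    e₄ = solve-∀
    x≡ : x ≡ + 3 * d
    x≡ = vanish 1ℤ (e₂ x z) t≡0
    y≡ : y ≡ + 4 * d
    y≡ = vanish (+ 2) (vanish 1ℤ (e₃ x y z) q≡0) t≡0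
    z≡ : z ≡ + 5 * d
    z≡ = vanish (+ 2) (e₄ x z) t≡0
    positive-unit : ∀ {i} → Pos i → i ∣ 1ℤ → i ≡ 1ℤ
    positive-unit (+<+ {n = suc n} _) i∣1 = cong +_ (ℕ.∣1⇒≡1 (∣⇒∣ᵤ i∣1))
    d≡1 : d ≡ 1ℤ
    d≡1 = positive-unit (pos-cancel {j = + 3} (+<+ ℕ.z<s) (by (trans x≡ (ℤ.*-comm (+ 3) d)) px))
      (prim (divides-all (divides (+ 3) x≡) (divides (+ 4) y≡) (divides (+ 5) z≡)))
    cong₃ : ∀ {a b c a′ b′ c′ : ℤ} → a ≡ a′ → b ≡ b′ → c ≡ c′ →
            _≡_ {A = Triple} (a ∷ b ∷ c ∷ []) (a′ ∷ b′ ∷ c′ ∷ [])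
    cong₃ refl refl refl = refl

  parent : v ≡ triple (β ∷ []) ⊎ ∃ λ ℓ → Positive (inverse ℓ *ᵥ v)
  parent = choose (ℤ.<-cmp 0ℤ p) (ℤ.<-cmp 0ℤ q)
    where
    e₁ : ∀ x y z → - (+ 2 * x + (+ 1 * y + (- + 2 * z + 0ℤ))) ≡ - + 2 * x + (- + 1 * y + (+ 2 * z + 0ℤ))
    e₁ = solve-∀
    e₂ : ∀ x y z → - (+ 1 * x + (+ 2 * y + (- + 2 * z + 0ℤ))) ≡ - + 1 * x + (- + 2 * y + (+ 2 * z + 0ℤ))
    e₂ = solve-∀
    choose : Tri (0ℤ < p) (0ℤ ≡ p) (p < 0ℤ) → Tri (0ℤ < q) (0ℤ ≡ q) (q < 0ℤ) →
             v ≡ triple (β ∷ []) ⊎ ∃ λ ℓ → Positive (inverse ℓ *ᵥ v)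
    choose (tri≈ _ p≡0 _) _              = ⊥-elim (p≢0 (sym p≡0))
    choose _              (tri≈ _ q≡0 _) = inj₁ (q≡0⇒345 (sym q≡0))
    choose (tri< p>0 _ _) (tri< q>0 _ _) = inj₂ (β , positive p>0 q>0 r-positive)
    choose (tri< p>0 _ _) (tri> _ _ q<0) =
      inj₂ (⟨ α ⟩ , positive p>0 (by (e₁ x y z) (pos-neg q<0)) r-positive)
    choose (tri> _ _ p<0) (tri< q>0 _ _) =
      inj₂ (⟨ γ ⟩ , positive (by (e₂ x y z) (pos-neg p<0)) q>0 r-positive)
    choose (tri> _ _ p<0) (tri> _ _ q<0) = ⊥-elim (¬both-negative (pos-neg p<0) (pos-neg q<0))

hypotenuse : Triple → ℤ
hypotenuse (x ∷ y ∷ z ∷ []) = z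

hypotenuse-inverse : ∀ ℓ {v} → Positive v → Good v → hypotenuse (inverse ℓ *ᵥ v) < hypotenuse v
hypotenuse-inverse ⟨ α ⟩ (positive px py pz) g = Descent.r<z px py pz g
hypotenuse-inverse β     (positive px py pz) g = Descent.r<z px py pz g
hypotenuse-inverse ⟨ γ ⟩ (positive px py pz) g = Descent.r<z px py pz g

<-suc⇒≤ : ∀ {i n} → i < + suc n → i ≤ + n
<-suc⇒≤ -<+             = -≤+
<-suc⇒≤ (+<+ (s≤s m≤n)) = +≤+ m≤n

-- Recursion on a strict bound `n` for the hypotenuse, which drops at every step to the parent. The
-- bound 0 contradicts positivity.
descend : ∀ n {v} → hypotenuse v < + n → Positive v → Good v → ∃ λ w → EndsInβ w × triple w ≡ v
descend zero    z<0 (positive _ _ pz) _ = ⊥-elim (ℤ.<-asym pz z<0)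
descend (suc n) {v} z<n pos@(positive px py pz) g with Descent.parent px py pz g
... | inj₁ eq          = β ∷ [] , [β] , sym eq
... | inj₂ (ℓ , pos′)
  with descend n (ℤ.<-≤-trans (hypotenuse-inverse ℓ pos g) (<-suc⇒≤ z<n)) pos′ (good-inverse ℓ g)
... | w , e , eq = ℓ ∷ w , ℓ ∷ e , trans (cong (mat ℓ *ᵥ_) eq) (mat-inverse ℓ v)

word-of : ∀ {v} → Positive v → Good v → ∃ λ w → EndsInβ w × triple w ≡ v
word-of pos@(positive {z = z} _ _ (+<+ {n = n} _)) g = descend (suc n) (+<+ (ℕ.n<1+n n)) pos g

-- Correspondence between `𝒫` and words

𝔓⇒positive : ∀ {v} → v ∈ 𝔓 → Positive v
𝔓⇒positive {x ∷ y ∷ z ∷ []} ((px , py , pz) , _) = positive px py pz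

𝔓⇒good : ∀ {v} → v ∈ 𝔓 → Good v
𝔓⇒good {x ∷ y ∷ z ∷ []} (_ , 2∣y , gcd≡1 , eq) = good (∣ᵤ⇒∣ 2∣y) prim (ℤ.i≡j⇒i-j≡0 eq)
  where
  prim : Primitive (x ∷ y ∷ z ∷ [])
  prim {d} (divides-all dx dy dz) = subst (d ∣_) gcd≡1 (∣ᵤ⇒∣ {d} {gcd (gcd x y) z}
    (gcd-greatest {gcd x y} {z} {d} (gcd-greatest {x} {y} {d} (∣⇒∣ᵤ dx) (∣⇒∣ᵤ dy)) (∣⇒∣ᵤ dz)))

good⇒𝔓 : ∀ {v} → Positive v → Good v → v ∈ 𝔓
good⇒𝔓 (positive {x} {y} {z} px py pz) (good even prim norm0) =
  (px , py , pz) , ∣⇒∣ᵤ even , cong +_ (ℕ.∣1⇒≡1 (∣⇒∣ᵤ g∣1)) , ℤ.i-j≡0⇒i≡j _ _ norm0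
  where
  g : ℤ
  g = gcd (gcd x y) z
  g∣xy : g ∣ gcd x y
  g∣xy = ∣ᵤ⇒∣ (gcd[i,j]∣i (gcd x y) z)
  g∣1 : g ∣ 1ℤ
  g∣1 = prim (divides-all (∣-trans g∣xy (∣ᵤ⇒∣ (gcd[i,j]∣i x y)))
    (∣-trans g∣xy (∣ᵤ⇒∣ (gcd[i,j]∣j x y))) (∣ᵤ⇒∣ (gcd[i,j]∣j (gcd x y) z)))

-- The comparison of fractions is by cross-multiplication, and the minimum is one of the two legs;
-- the leg it equals gives the side.
thin⇒slack : ∀ {v} → v ∈ Thin → ∃ λ s → Pos (slack s v)
thin⇒slack {x ∷ y ∷ z ∷ []} (*<* lt) with ℤ.⊓-sel x y
... | inj₁ eq = α , by (e x z) (<⇒pos (subst (λ m → m * + 2 < z * + 1) eq lt))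
  where
  e : ∀ x z → z * + 1 - x * + 2 ≡ z - (x + x)
  e = solve-∀
... | inj₂ eq = γ , by (e y z) (<⇒pos (subst (λ m → m * + 2 < z * + 1) eq lt))
  where
  e : ∀ x z → z * + 1 - x * + 2 ≡ z - (x + x)
  e = solve-∀

slack⇒thin : ∀ s {v} → Pos (slack s v) → v ∈ Thin
slack⇒thin α {x ∷ y ∷ z ∷ []} p =
  *<* (ℤ.≤-<-trans (ℤ.*-monoʳ-≤-nonNeg (+ 2) (ℤ.i⊓j≤i x y)) (pos⇒< (by (e x z) p)))
  where
  e : ∀ x z → z - (x + x) ≡ z * + 1 - x * + 2
  e = solve-∀
slack⇒thin γ {x ∷ y ∷ z ∷ []} p =
  *<* (ℤ.≤-<-trans (ℤ.*-monoʳ-≤-nonNeg (+ 2) (ℤ.i⊓j≤j x y)) (pos⇒< (by (e y z) p)))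
  where
  e : ∀ x z → z - (x + x) ≡ z * + 1 - x * + 2
  e = solve-∀

triple∈𝒫 : ∀ {w} → HWord′ w → triple w ∈ 𝒫
triple∈𝒫 {w} (inj₁ (hword e s h)) =
  inj₁ (good⇒𝔓 (positive-triple e) (good-triple w) , slack⇒thin s (head⇒slack e h))
triple∈𝒫 (inj₂ refl) = root∈𝒫

𝒫⇒word : ∀ {v} → v ∈ 𝒫 → ∃ λ w → HWord′ w × triple w ≡ v
𝒫⇒word (inj₂ refl) = [] , inj₂ refl , refl
𝒫⇒word (inj₁ (v∈𝔓 , thin)) with word-of (𝔓⇒positive v∈𝔓) (𝔓⇒good v∈𝔓) | thin⇒slack thin
... | w , e , refl | s , p = w , inj₁ (hword e s (slack⇒head s e p)) , refl

-- The monoid H′ and its action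

hword′-closed : ∀ {u v} → HWord′ u → HWord′ v → HWord′ (u ++ v)
hword′-closed (inj₁ h)    h′ = inj₁ (hword′-++ h h′)
hword′-closed (inj₂ refl) h′ = h′

H′-isSubmonoid : IsSubmonoid matrixMonoid H′
H′-isSubmonoid = record
  { ε-closed = inj₂ refl
  ; ∙-closed = λ m n → closed (H′⇒hword′ m) (H′⇒hword′ n)
  }
  where
  closed : ∀ {M N} → (∃ λ u → HWord′ u × eval u ≡ M) → (∃ λ v → HWord′ v × eval v ≡ N) → M *ₘ N ∈ H′
  closed (u , hu , refl) (v , hv , refl) = subst H′ (eval-++ u v) (eval∈H′ (hword′-closed hu hv))

H′-monoid : Monoid 0ℓ 0ℓ
H′-monoid = submonoid matrixMonoid H′-isSubmonoid

open Monoid H′-monoid using (Carrier; rawMonoid; ε; _∙_)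

eval-injective : ∀ {u v} → HWord′ u → HWord′ v → eval u ≡ eval v → u ≡ v
eval-injective {u} {v} hu hv eq = triple-injective′ hu hv
  (trans (sym (eval-root u)) (trans (cong (_*ᵥ root) eq) (eval-root v)))

-- Both matrices are values of words of `H′`, and such a word is determined by its triple.
orbit-injective : ∀ {M N} → M ∈ H′ → N ∈ H′ → M *ᵥ root ≡ N *ᵥ root → M ≡ N
orbit-injective m n = compare (H′⇒hword′ m) (H′⇒hword′ n)
  where
  compare : ∀ {M N} → (∃ λ u → HWord′ u × eval u ≡ M) → (∃ λ v → HWord′ v × eval v ≡ N) →
            M *ᵥ root ≡ N *ᵥ root → M ≡ N
  compare (u , hu , refl) (v , hv , refl) eq =
    cong eval (triple-injective′ hu hv (trans (sym (eval-root u)) (trans eq (eval-root v))))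

gen : Generator → Carrier
gen i = eval (proj₁ i) , eval∈H′ (inj₁ (generator-hword i))

fold-gen : ∀ is → proj₁ (foldMap rawMonoid gen is) ≡ eval (flatten is)
fold-gen []       = refl
fold-gen (i ∷ is) = trans (cong (eval (proj₁ i) *ₘ_) (fold-gen is)) (sym (eval-++ (proj₁ i) (flatten is)))

-- Unique factorisation of words, carried over to matrices: `eval` is injective on the words of `H′`
-- because the action on the root already separates them.
freelyGenerates : FreelyGenerates H′-monoid gen
freelyGenerates = record
  { isMonoidMonomorphism = record
    { isMonoidHomomorphism = foldMap-morphism H′-monoid gen
    ; injective = λ {is} {js} eq → flatten-injective is js
        (eval-injective (flatten-hword′ is) (flatten-hword′ js)
          (trans (sym (fold-gen is)) (trans eq (fold-gen js))))
    }
  ; surjective = λ (M , m) → factorise (H′⇒hword′ m)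
  }
  where
  factorise : ∀ {M} → (∃ λ w → HWord′ w × eval w ≡ M) →
              ∃ λ is → ∀ {js} → js ≡ is → proj₁ (foldMap rawMonoid gen js) ≡ M
  factorise (w , h , refl) with factor h
  ... | is , refl = is , λ { refl → fold-gen is }

eval-triple : ∀ u w → eval u *ᵥ triple w ≡ triple (u ++ w)
eval-triple []      w = I₃-*ᵥ (triple w)
eval-triple (ℓ ∷ u) w = trans (*ᵥ-assoc (mat ℓ) (eval u) (triple w)) (cong (mat ℓ *ᵥ_) (eval-triple u w))

H′-actsOn-𝒫 : ActsOn H′ 𝒫
H′-actsOn-𝒫 = record
  { closed     = λ m v∈ → closed (H′⇒hword′ m) (𝒫⇒word v∈)
  ; identity   = λ {v} _ → I₃-*ᵥ v
  ; compatible = λ {M} {N} {v} _ _ _ → *ᵥ-assoc M N v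
  }
  where
  closed : ∀ {M v} → (∃ λ u → HWord′ u × eval u ≡ M) → (∃ λ w → HWord′ w × triple w ≡ v) → M *ᵥ v ∈ 𝒫
  closed (u , hu , refl) (w , hw , refl) = subst 𝒫 (sym (eval-triple u w)) (triple∈𝒫 (hword′-closed hu hw))

reach : ∀ {v} → v ∈ 𝒫 → ∃ λ M → M ∈ H′ × M *ᵥ root ≡ v
reach v∈ with 𝒫⇒word v∈
... | w , h , eq = eval w , eval∈H′ h , trans (eval-root w) eq

reach-unique : ∀ v → v ∈ 𝒫 → ∃! _≡_ λ M → M ∈ H′ × M *ᵥ root ≡ v
reach-unique v v∈ = unique (reach v∈)
  where
  unique : (∃ λ M → M ∈ H′ × M *ᵥ root ≡ v) → ∃! _≡_ λ M → M ∈ H′ × M *ᵥ root ≡ v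
  unique (M , m , eq) = M , (m , eq) , λ (n , eq′) → orbit-injective m n (trans eq (sym eq′))

orbit : Carrier → Σ Triple 𝒫
orbit = orbitMap H′-isSubmonoid H′-actsOn-𝒫

orbit-isRootedIsomorphism :
  IsRootedIsomorphism (cayley H′-monoid (Range H′-monoid gen))
    (orbitDigraph H′-isSubmonoid H′-actsOn-𝒫 (Range H′-monoid gen))
    ε (root , root∈𝒫) orbit
orbit-isRootedIsomorphism = record
  { isBijection = record
    { isInjection = record
      { isCongruent = record
        { cong           = cong (_*ᵥ root)
        ; isEquivalence₁ = Monoid.isEquivalence H′-monoid
        ; isEquivalence₂ = On.isEquivalence proj₁ ≡.isEquivalence
        }
      ; injective = λ {g} {h} → orbit-injective (proj₂ g) (proj₂ h)
      }
    ; surjective = λ (v , v∈) → preimage (reach v∈)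
    }
  ; edge⇔ = λ g h → mk⇔
      (λ (x , x∈ , h≈gx) → g , x , x∈ , refl , cong (_*ᵥ root) h≈gx)
      -- An edge of the orbit digraph carries its own `g′` over the source vertex; injectivity of
      -- the orbit map identifies it with `g`.
      (λ (g′ , x , x∈ , eq , eq′) → x , x∈ , trans
        (orbit-injective (proj₂ h) (proj₂ (g′ ∙ x)) eq′)
        (cong (_*ₘ proj₁ x) (sym (orbit-injective (proj₂ g) (proj₂ g′) eq))))
  ; root = refl
  }
  where
  preimage : ∀ {v} → (∃ λ M → M ∈ H′ × M *ᵥ root ≡ v) →
             ∃ λ (g : Carrier) → ∀ {h : Carrier} → proj₁ h ≡ proj₁ g → proj₁ (orbit h) ≡ v
  preimage (M , m , eq) = (M , m) , λ h≡ → trans (cong (_*ᵥ root) h≡) eq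

open FreeMonoid H′-monoid gen freelyGenerates using (¬finitelyGenerated; regularTree)

theorem2p2 : Σ (IsSubmonoid matrixMonoid H′) λ isSub →
    let H′-monoid = submonoid matrixMonoid isSub in
    IsFree H′-monoid
    × ¬ FinitelyGenerated H′-monoid
    × Σ (ActsOn H′ 𝒫) λ acts →
    (∀ v → v ∈ 𝒫 → ∃! _≡_ λ M → M ∈ H′ × M *ᵥ root ≡ v)
    × ∃ λ (Gen : Set) → ∃ λ (gen : Gen → Monoid.Carrier H′-monoid) →
    let Γ = cayley H′-monoid (Range H′-monoid gen) in
    FreelyGenerates H′-monoid gen
    × IsRootedIsomorphism Γ (orbitDigraph isSub acts (Range H′-monoid gen)) (Monoid.ε H′-monoid) (root , root∈𝒫) (orbitMap isSub acts)
    × IsRegularInfiniteTreeOfInfiniteDegree Γ (Monoid.ε H′-monoid)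
theorem2p2 =
    H′-isSubmonoid
  , (Generator , gen , freelyGenerates)
  , ¬finitelyGenerated size size-unbounded
  , H′-actsOn-𝒫
  , reach-unique
  , Generator , gen , freelyGenerates , orbit-isRootedIsomorphism
  , regularTree αβⁿ αβⁿ-injective
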